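{- For every integer $d\ge 0$ there is a polynomial $p$ (depending only on $d$) such that the following holds. Let $G$ be a graph with VC dimension at most $d$, and let $\varepsilon>0$. Then there is a partition of $V(G)$ into $K\leq 2^{2^{p(1/\varepsilon)}}$ parts such that at least a $(1-\varepsilon)$-fraction of the pairs $(x,y)\in V(G)^2$ lie in $\varepsilon$-homogeneous pairs of parts.
   Context: Graphs are finite and simple. The VC dimension of a family $\mathcal{F}\subseteq 2^V$ is the largest size of a set $S\subseteq V$ such that every subset of $S$ is of the form $S\cap F$ for some $F\in\mathcal{F}$. The VC dimension of a graph $G$ is the VC dimension of the family of neighborhoods $\{N(v):v\in V(G)\}\subseteq 2^{V(G)}$. For vertex sets $X,Y\subseteq V(G)$, $d(X,Y)=|\{(x,y)\in X\times Y:xy\in E(G)\}|/(|X||Y|)$. A pair $(X,Y)$ is $\varepsilon$-homogeneous if $d(X,Y)\in[0,\varepsilon]\cup[1-\varepsilon,1]$. A pair of vertices $(x,y)$ lies in the pair of parts $(V_i,V_j)$ (possibly $i=j$) with $x\in V_i$, $y\in V_j$. -}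

module Defs where

open import Data.Bool.Base using (Bool; true; false; T)
open import Data.Fin.Base using (Fin)
open import Data.Fin.Properties using () renaming (_≟_ to _≟ᶠ_)
open import Data.Fin.Subset using (Subset; _⊆_; _∩_; ∣_∣)
open import Data.Fin.Subset.Properties using (_∈?_)
open import Data.Integer.Base using (+_)
open import Data.List.Base using (List; []; _∷_; allFin; cartesianProduct; filter; filterᵇ; length)
open import Data.Nat.Base as ℕ using (ℕ; zero; suc)
open import Data.Product.Base using (_×_; _,_; ∃; ∃₂)
open import Data.Rational.Base as ℚ using (ℚ; 0ℚ; 1ℚ; _/_; +-*-rawSemiring)
open import Data.Sum.Base using (_⊎_)
open import Data.Vec.Base using (tabulate)
open import Function.Bundles using (_⇔_)
open import Function.Definitions using (Surjective)
open import Level using (0ℓ)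
open import Relation.Binary.PropositionalEquality using (_≡_)
open import Relation.Nullary using (¬_)
open import Relation.Nullary.Decidable using (⌊_⌋; T?; _×-dec_)
open import Relation.Unary using (Pred)
open import Algebra.Definitions.RawSemiring +-*-rawSemiring using (_^_)

fromℕ : ℕ → ℚ
fromℕ m = + m / 1

------------------------------------------------------------------------
-- Real numbers, as two-sided Dedekind cuts

record ℝ : Set₁ where
  field
    lower           : Pred ℚ 0ℓ
    upper           : Pred ℚ 0ℓ
    lower-inhabited : ∃ lower
    upper-inhabited : ∃ upper
    lower-rounded   : ∀ q → lower q ⇔ (∃ λ r → q ℚ.< r × lower r)
    upper-rounded   : ∀ q → upper q ⇔ (∃ λ r → r ℚ.< q × upper r)
    disjoint        : ∀ q → ¬ (lower q × upper q)
    located         : ∀ {q r} → q ℚ.< r → lower q ⊎ upper r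

infix 4 _<ʳ_ _ʳ<_

_<ʳ_ : ℚ → ℝ → Set
q <ʳ x = ℝ.lower x q

_ʳ<_ : ℝ → ℚ → Set
x ʳ< q = ℝ.upper x q

-- The bound 2 ^ (2 ^ p (1 / ε)) is a real expression built from positive ε
-- by operations that are continuous and monotone on the nonnegative reals.
-- A nonnegative real is represented there by the set of rationals strictly
-- above it, which determines it.

UpperCut : Set₁
UpperCut = Pred ℚ 0ℓ

fromℕᵘ : ℕ → UpperCut
fromℕᵘ m q = fromℕ m ℚ.< q

infixl 6 _+ᵘ_
infixl 7 _*ᵘ_

_+ᵘ_ : UpperCut → UpperCut → UpperCut
(x +ᵘ y) q = ∃₂ λ a b → x a × y b × a ℚ.+ b ℚ.≤ q

-- The product of two nonnegative reals: a and b below are positive, being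
-- strictly above nonnegative reals.
_*ᵘ_ : UpperCut → UpperCut → UpperCut
(x *ᵘ y) q = ∃₂ λ a b → x a × y b × a ℚ.* b ℚ.≤ q

-- 1 / x for positive x: 1 / x < q iff 1 / r ≤ q for some 0 < r < x.
1/ᵘ_ : ℝ → UpperCut
(1/ᵘ x) q = ∃ λ r → 0ℚ ℚ.< r × r <ʳ x × 1ℚ ℚ.≤ q ℚ.* r

-- 2 to the power of a nonnegative real x: 2 ^ x < q iff 2 ^ (m / k) ≤ q for
-- some rational m / k > x with k = suc k-1, where 2 ^ (m / k) ≤ q means
-- 2 ^ m ≤ q ^ k for positive q.
2^ᵘ_ : UpperCut → UpperCut
(2^ᵘ x) q = ∃₂ λ m k-1 →
  x (+ m / suc k-1) × 0ℚ ℚ.< q × fromℕ (2 ℕ.^ m) ℚ.≤ q ^ suc k-1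

infix 4 _≤ᵘ_

_≤ᵘ_ : ℕ → UpperCut → Set
m ≤ᵘ x = ∀ q → x q → fromℕ m ℚ.≤ q

-- Coefficient lists, constant term first. Natural coefficients lose no
-- generality in an upper bound: on positive arguments every real polynomial
-- is dominated by such a polynomial.
Polynomial : Set
Polynomial = List ℕ

evalᵘ : Polynomial → UpperCut → UpperCut
evalᵘ []      x = fromℕᵘ 0
evalᵘ (c ∷ p) x = fromℕᵘ c +ᵘ x *ᵘ evalᵘ p x

------------------------------------------------------------------------
-- VC dimension

Shatters : ∀ {n} → Pred (Subset n) 0ℓ → Subset n → Set
Shatters 𝓕 S = ∀ T → T ⊆ S → ∃ λ F → 𝓕 F × T ≡ S ∩ F

VCDim≤ : ∀ {n} → Pred (Subset n) 0ℓ → ℕ → Set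
VCDim≤ 𝓕 d = ∀ S → Shatters 𝓕 S → ∣ S ∣ ℕ.≤ d

------------------------------------------------------------------------
-- Graphs

record Graph (n : ℕ) : Set where
  field
    adj    : Fin n → Fin n → Bool
    sym    : ∀ x y → adj x y ≡ adj y x
    irrefl : ∀ x → adj x x ≡ false

allPairs : ∀ n → List (Fin n × Fin n)
allPairs n = cartesianProduct (allFin n) (allFin n)

module _ {n : ℕ} (G : Graph n) where
  open Graph G

  N : Fin n → Subset n
  N v = tabulate (adj v)

  Neighborhoods : Pred (Subset n) 0ℓ
  Neighborhoods F = ∃ λ v → F ≡ N v

  GraphVCDim≤ : ℕ → Set
  GraphVCDim≤ = VCDim≤ Neighborhoods

  edgePairs : Subset n → Subset n → ℕ
  edgePairs X Y = length (filter
    (λ (x , y) → (x ∈? X) ×-dec ((y ∈? Y) ×-dec T? (adj x y)))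
    (allPairs n))

  -- The value 0 for an empty X or Y is a convention; parts of a partition are
  -- nonempty.
  density : Subset n → Subset n → ℚ
  density X Y with ∣ X ∣ ℕ.* ∣ Y ∣
  ... | zero  = 0ℚ
  ... | suc m = + edgePairs X Y / suc m

  -- A non-strict inequality monotone in ε is expressed as its holding for all
  -- rationals above ε.
  Homogeneous : ℝ → Subset n → Subset n → Set
  Homogeneous ε X Y =
      (0ℚ ℚ.≤ δ × (∀ q → ε ʳ< q → δ ℚ.≤ q))
    ⊎ ((∀ q → ε ʳ< q → 1ℚ ℚ.- q ℚ.≤ δ) × δ ℚ.≤ 1ℚ)
    where δ = density X Y

-- Partitions into exactly K (nonempty) parts.
record Partition (n K : ℕ) : Set where
  field
    part       : Fin n → Fin K
    surjective : Surjective _≡_ _≡_ part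

  cell : Fin K → Subset n
  cell i = tabulate λ x → ⌊ part x ≟ᶠ i ⌋

-- At least a (1 - ε)-fraction of the pairs in V × V satisfy P. As P need not
-- be decidable, this is witnessed by a decidable set H of pairs satisfying P
-- with (1 - ε) * n² ≤ |H|.
MostPairs : ∀ {n} → ℝ → (Fin n → Fin n → Set) → Set
MostPairs {n} ε P = ∃ λ (H : Fin n → Fin n → Bool) →
    (∀ x y → T (H x y) → P x y)
  × (∀ q → ε ʳ< q →
       (1ℚ ℚ.- q) ℚ.* fromℕ (n ℕ.* n)
         ℚ.≤ fromℕ (length (filterᵇ (λ (x , y) → H x y) (allPairs n))))

module Submission where

-- Call two vertices far if their neighborhoods differ in at least n / a places,
-- a = 1 / ε². Greedily chosen vertices separate m pairwise far vertices using a
-- set of O (a log m) coordinates, so Sauer–Shelah gives m ≤ O (a log m + 1) ^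
-- (d + 1), hence m ≤ 2 ^ O (a). Take a maximal family of pairwise far vertices
-- and classify every vertex x by a member r (x) of the family that is not far
-- from it, together with its adjacencies to all members. Then adj (r (x)) y
-- depends only on the classes of x and y and errs on at most ε² n² pairs, so by
-- Markov's inequality at most ε n² pairs lie in pairs of classes in which the
-- fraction of errors exceeds ε.

open import Defs
open import Data.Nat.Base as ℕ using (ℕ; suc)
open import Data.Fin.Base using (Fin)
open import Data.Product.Base using (Σ; ∃; _×_; _,_)
open import Data.Rational.Base using (0ℚ)
open import Relation.Binary.PropositionalEquality
  using (_≡_; _≢_; refl; sym; trans; cong; cong₂; subst; subst₂; module ≡-Reasoning)

-- The real ε enters only at the ends. There is a natural s with s ≤ 1 / ε and 1 / (s + 2) < ε; all
-- counting is done for 1 / (s + 2) in place of ε, over the natural numbers with denominators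
-- cleared. Polynomials have natural coefficients, hence are monotone, so a bound by the value at s
-- is a bound by the value at 1 / ε. The inequality for m is implicit, since the number of
-- separating coordinates itself grows with log m. It is never solved: it is refuted at m = 2 ^ L
-- for an explicit L that is linear in a, and any larger packing contains one of exactly this size.
-- The approximation is constant on pairs of classes because the class of x determines r (x) and the
-- class of y determines its adjacency to every member, in particular to r (x). Recording all these
-- adjacencies costs a factor 2 ^ m, which produces the second exponential. The square in a = 1 / ε²
-- is spent as one factor ε for the error threshold within a pair of classes and one for the
-- fraction of exceptional pairs.

module Combinatorics where

  open import Data.Bool.Base using (Bool; true; false; not; _∧_; _∨_; _xor_; if_then_else_; T)
  open import Data.Bool.Properties using (T?; ∧-identityʳ; xor-same) renaming (_≟_ to _≟ᵇ_)
  open import Data.Fin.Base using (zero; suc; combine; funToFin; finToFun; punchOut)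
  open import Data.Fin.Properties
    using (_≟_; any?; all?; ¬∀⟶∃¬; nonZeroIndex; punchOut-injective; combine-injective; finToFun-funToFin)
  open import Data.Fin.Subset using (Subset; inside; outside; ⊥; ⁅_⁆; _∈_; _⊆_; _∩_; _∪_; ∣_∣)
  open import Data.Fin.Subset.Properties
    using (_∈?_; ⊆-min; ⊆-antisym; ∣⊥∣≡0; ∣⁅x⁆∣≡1; ∣p∣≤∣x∷p∣; ∩-zeroˡ; p∩q⊆p; p∩q⊆q; x∈p∩q⁺; x∈p∪q⁺; x∈⁅x⁆; drop-∷-⊆; s⊆s; out⊆)
  open import Data.List.Base
    using (List; []; _∷_; _++_; length; map; filter; filterᵇ; take; tabulate; allFin; cartesianProduct; lookup)
  open import Data.List.Membership.Propositional.Properties using (∈-allFin)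
  open import Data.List.Properties using (length-map; length-++; length-take; map-tabulate; filter-++)
  open import Data.List.Relation.Unary.All as All using (All; []; _∷_)
  import Data.List.Relation.Unary.All.Properties as All
  open import Data.List.Relation.Unary.AllPairs as AllPairs using (AllPairs; []; _∷_)
  import Data.List.Relation.Unary.AllPairs.Properties as AllPairs
  open import Data.List.Relation.Unary.Any as Any using (Any; here; there; index)
  open import Data.List.Relation.Unary.Any.Properties using (lookup-index)
  open import Data.Nat.Base hiding (∣_-_∣)
  open import Data.Nat.Properties hiding (_≟_)
  open import Data.Nat.Tactic.RingSolver using (solve-∀)
  open import Data.Product.Base using (proj₁; proj₂; uncurry)
  open import Data.Sum.Base using (_⊎_; inj₁; inj₂)
  open import Data.Vec.Base as Vec using ([]; _∷_; here; there)
  open import Data.Vec.Properties using (≡-dec; lookup∘tabulate; lookup-zipWith; []=⇒lookup)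
  open import Function.Base using (_∘_; id; case_of_)
  open import Function.Definitions using (Surjective)
  open import Level using (0ℓ)
  open import Relation.Nullary using (¬_; Dec; yes; no; does; contradiction)
  open import Relation.Nullary.Decidable using (⌊_⌋; _×-dec_; toWitness)
  open import Relation.Unary using (Pred; Decidable)
  open import Algebra.Properties.Semiring.Sum +-*-semiring
    using (sum; sum-syntax; sum-cong-≗; ∑-distrib-+; ∑-comm; *-distribˡ-sum; *-distribʳ-sum)

  private
    variable
      n : ℕ
      A : Set

  -- The Sauer–Shelah lemma

  ind : Bool → ℕ
  ind b = if b then 1 else 0

  -- Boolean-valued, so that `card` can count members by recursion on the ground set and unions and
  -- intersections are pointwise.
  Family : ℕ → Set
  Family n = Subset n → Bool

  Members : Family n → Subset n → Set
  Members F T = F T ≡ true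

  card : Family n → ℕ
  card {zero}  F = ind (F [])
  card {suc n} F = card (F ∘ (inside ∷_)) + card (F ∘ (outside ∷_))

  ind-mono : ∀ a b → (a ≡ true → b ≡ true) → ind a ≤ ind b
  ind-mono false b     _   = z≤n
  ind-mono true  true  _   = ≤-refl
  ind-mono true  false a⇒b = case a⇒b refl of λ ()

  card-mono : (F G : Family n) → (∀ T → Members F T → Members G T) → card F ≤ card G
  card-mono {zero}  F G F⊆G = ind-mono (F []) (G []) (F⊆G [])
  card-mono {suc n} F G F⊆G = +-mono-≤ (card-mono _ _ (F⊆G ∘ (inside ∷_))) (card-mono _ _ (F⊆G ∘ (outside ∷_)))

  card-mono-< : (F G : Family n) (U : Subset n) → (∀ T → Members F T → Members G T) →
                F U ≡ false → Members G U → card F < card G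
  card-mono-< F G []          F⊆G U∉F U∈G rewrite U∉F | U∈G = ≤-refl
  card-mono-< F G (true  ∷ U) F⊆G U∉F U∈G =
    +-mono-<-≤ (card-mono-< _ _ U (F⊆G ∘ (inside ∷_)) U∉F U∈G) (card-mono _ _ (F⊆G ∘ (outside ∷_)))
  card-mono-< F G (false ∷ U) F⊆G U∉F U∈G =
    +-mono-≤-< (card-mono _ _ (F⊆G ∘ (inside ∷_))) (card-mono-< _ _ U (F⊆G ∘ (outside ∷_)) U∉F U∈G)

  card-∅ : (F : Family n) → (∀ T → F T ≡ false) → card F ≡ 0
  card-∅ {zero}  F F≡∅ = cong ind (F≡∅ [])
  card-∅ {suc n} F F≡∅ = cong₂ _+_ (card-∅ _ (F≡∅ ∘ (inside ∷_))) (card-∅ _ (F≡∅ ∘ (outside ∷_)))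

  card-inhabited : (F : Family n) → 0 < card F → ∃ (Members F)
  card-inhabited {zero}  F 0<F with F [] in eq
  ... | true = [] , eq
  card-inhabited {suc n} F 0<F with card (F ∘ (inside ∷_)) in eq
  ... | zero  = let U , U∈F = card-inhabited _ 0<F in outside ∷ U , U∈F
  ... | suc _ = let U , U∈F = card-inhabited (F ∘ (inside ∷_)) (subst (0 <_) (sym eq) z<s) in inside ∷ U , U∈F

  ind-∨∧ : ∀ a b → ind a + ind b ≡ ind (a ∨ b) + ind (a ∧ b)
  ind-∨∧ true  true  = refl
  ind-∨∧ true  false = refl
  ind-∨∧ false b     = sym (+-identityʳ (ind b))

  card-∨∧ : (F G : Family n) → card F + card G ≡ card (λ T → F T ∨ G T) + card (λ T → F T ∧ G T)
  card-∨∧ {zero}  F G = ind-∨∧ (F []) (G [])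
  card-∨∧ {suc n} F G = begin
    (card F₁ + card F₀) + (card G₁ + card G₀)              ≡⟨ +-interchange (card F₁) _ _ _ ⟩
    (card F₁ + card G₁) + (card F₀ + card G₀)              ≡⟨ cong₂ _+_ (card-∨∧ F₁ G₁) (card-∨∧ F₀ G₀) ⟩
    (card F₁∨G₁ + card F₁∧G₁) + (card F₀∨G₀ + card F₀∧G₀)  ≡⟨ +-interchange (card F₁∨G₁) _ _ _ ⟩
    (card F₁∨G₁ + card F₀∨G₀) + (card F₁∧G₁ + card F₀∧G₀)  ∎
    where
    open ≡-Reasoning
    F₁ = F ∘ (inside ∷_)
    F₀ = F ∘ (outside ∷_)
    G₁ = G ∘ (inside ∷_)
    G₀ = G ∘ (outside ∷_)
    F₁∨G₁ = λ T → F₁ T ∨ G₁ T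
    F₀∨G₀ = λ T → F₀ T ∨ G₀ T
    F₁∧G₁ = λ T → F₁ T ∧ G₁ T
    F₀∧G₀ = λ T → F₀ T ∧ G₀ T
    +-interchange : ∀ a b c d → (a + b) + (c + d) ≡ (a + c) + (b + d)
    +-interchange = solve-∀

  _≟ˢ_ : (S T : Subset n) → Dec (S ≡ T)
  _≟ˢ_ = ≡-dec _≟ᵇ_

  -- Induction on the list, removing its head from the family: distinctness keeps the tail inside
  -- what remains, and the removal lowers the cardinality strictly.
  length≤card : (F : Family n) (Ts : List (Subset n)) → AllPairs _≢_ Ts → All (Members F) Ts → length Ts ≤ card F
  length≤card F []       _               _            = z≤n
  length≤card F (T ∷ Ts) (T≢Ts ∷ distinct) (T∈F ∷ Ts∈F) =
    ≤-<-trans (length≤card F∖T Ts distinct (All.zipWith keep (T≢Ts , Ts∈F))) (card-mono-< F∖T F T F∖T⊆F T∉F∖T T∈F)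
    where
    F∖T : Family _
    F∖T U = F U ∧ not (does (U ≟ˢ T))
    keep : ∀ {U} → T ≢ U × Members F U → Members F∖T U
    keep {U} (T≢U , U∈F) with U ≟ˢ T
    ... | yes U≡T = contradiction (sym U≡T) T≢U
    ... | no _    = trans (∧-identityʳ (F U)) U∈F
    F∖T⊆F : ∀ U → Members F∖T U → Members F U
    F∖T⊆F U U∈ with F U
    ... | true = refl
    T∉F∖T : F∖T T ≡ false
    T∉F∖T with F T | T ≟ˢ T
    ... | true  | yes _  = refl
    ... | true  | no T≢T = contradiction refl T≢T
    ... | false | _      = refl

  -- Φ d s is the maximal number of distinct traces on s points when no d of
  -- them are shattered.
  Φ : ℕ → ℕ → ℕ
  Φ zero    s       = 0
  Φ (suc d) zero    = 1
  Φ (suc d) (suc s) = Φ (suc d) s + Φ d s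

  -- `Φ d s` is the sum of the binomial coefficients C(s, i) over i < d. Only its polynomial growth
  -- in s matters later.
  Φ≤ : ∀ d s → Φ d s ≤ suc s ^ d
  Φ≤ zero    s       = z≤n
  Φ≤ (suc d) zero    = ≤-reflexive (sym (^-zeroˡ (suc d)))
  Φ≤ (suc d) (suc s) = begin
    Φ (suc d) s + Φ d s            ≤⟨ +-mono-≤ (Φ≤ (suc d) s) (Φ≤ d s) ⟩
    suc s * suc s ^ d + suc s ^ d  ≡⟨ +-comm (suc s * suc s ^ d) _ ⟩
    suc (suc s) * suc s ^ d        ≤⟨ *-monoʳ-≤ (suc (suc s)) (^-monoˡ-≤ d (n≤1+n (suc s))) ⟩
    suc (suc s) ^ suc d            ∎
    where open ≤-Reasoning

  ∨-true : ∀ a b → a ∨ b ≡ true → a ≡ true ⊎ b ≡ true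
  ∨-true true  b _  = inj₁ refl
  ∨-true false b eq = inj₂ eq

  ∧-true : ∀ a b → a ∧ b ≡ true → a ≡ true × b ≡ true
  ∧-true true true _ = refl , refl

  -- The halves F₁, F₀ of F at the first point satisfy
  -- |F₁| + |F₀| = |F₁ ∪ F₀| + |F₁ ∩ F₀|, and a set shattered by F₁ ∩ F₀ remains
  -- shattered by F when that point is added.
  sauer-shelah : ∀ d (M : Subset n) (F : Family n) → (∀ T → Members F T → T ⊆ M) → Φ d ∣ M ∣ < card F →
                 ∃ λ S → S ⊆ M × ∣ S ∣ ≡ d × Shatters (Members F) S
  sauer-shelah {n} zero M F F⊆M Φ<F with card-inhabited F Φ<F
  ... | U , U∈F = ⊥ , ⊆-min M , ∣⊥∣≡0 n ,
    λ T T⊆⊥ → U , U∈F , trans (⊆-antisym T⊆⊥ (⊆-min T)) (sym (∩-zeroˡ U))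
  sauer-shelah (suc d) [] F F⊆M Φ<F with F [] | Φ<F
  ... | true  | s≤s ()
  ... | false | ()
  sauer-shelah (suc d) (false ∷ M) F F⊆M Φ<F
    with sauer-shelah (suc d) M (F ∘ (outside ∷_)) (λ T T∈F → drop-∷-⊆ (F⊆M _ T∈F))
           (subst (λ c → Φ (suc d) ∣ M ∣ < c + card (F ∘ (outside ∷_))) (card-∅ _ F₁-empty) Φ<F)
    where
    F₁-empty : ∀ T → F (inside ∷ T) ≡ false
    F₁-empty T with F (inside ∷ T) in eq
    ... | false = refl
    ... | true  = case F⊆M _ eq here of λ ()
  ... | S , S⊆M , ∣S∣≡d , shattered = outside ∷ S , out⊆ S⊆M , ∣S∣≡d , shattered′
    where
    shattered′ : Shatters (Members F) (outside ∷ S)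
    shattered′ (true  ∷ T) T⊆S = case T⊆S here of λ ()
    shattered′ (false ∷ T) T⊆S with shattered T (drop-∷-⊆ T⊆S)
    ... | U , U∈F , T≡S∩U = outside ∷ U , U∈F , cong (outside ∷_) T≡S∩U
  sauer-shelah (suc d) (true ∷ M) F F⊆M Φ<F
    with Φ (suc d) ∣ M ∣ <? card (λ T → F (inside ∷ T) ∨ F (outside ∷ T))
  ... | yes Φ<∨
    with sauer-shelah (suc d) M (λ T → F (inside ∷ T) ∨ F (outside ∷ T)) ∨⊆M Φ<∨
    where
    ∨⊆M : ∀ T → F (inside ∷ T) ∨ F (outside ∷ T) ≡ true → T ⊆ M
    ∨⊆M T T∈∨ with ∨-true (F (inside ∷ T)) _ T∈∨
    ... | inj₁ T∈F₁ = drop-∷-⊆ (F⊆M _ T∈F₁)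
    ... | inj₂ T∈F₀ = drop-∷-⊆ (F⊆M _ T∈F₀)
  ... | S , S⊆M , ∣S∣≡d , shattered = outside ∷ S , out⊆ S⊆M , ∣S∣≡d , shattered′
    where
    shattered′ : Shatters (Members F) (outside ∷ S)
    shattered′ (true  ∷ T) T⊆S = case T⊆S here of λ ()
    shattered′ (false ∷ T) T⊆S with shattered T (drop-∷-⊆ T⊆S)
    -- The first point lies outside the shattered set, so either half may supply the trace.
    ... | U , U∈∨ , T≡S∩U with ∨-true (F (inside ∷ U)) _ U∈∨
    ...   | inj₁ U∈F₁ = inside  ∷ U , U∈F₁ , cong (outside ∷_) T≡S∩U
    ...   | inj₂ U∈F₀ = outside ∷ U , U∈F₀ , cong (outside ∷_) T≡S∩U
  sauer-shelah (suc d) (true ∷ M) F F⊆M Φ<F | no Φ≮∨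
    with sauer-shelah d M (λ T → F (inside ∷ T) ∧ F (outside ∷ T))
           (λ T T∈∧ → drop-∷-⊆ (F⊆M _ (proj₁ (∧-true _ _ T∈∧)))) Φ<∧
    where
    Φ<∧ : Φ d ∣ M ∣ < card (λ T → F (inside ∷ T) ∧ F (outside ∷ T))
    Φ<∧ = ≰⇒> λ ∧≤Φ → <⇒≱ Φ<F (≤-trans (≤-reflexive (card-∨∧ (F ∘ (inside ∷_)) _)) (+-mono-≤ (≮⇒≥ Φ≮∨) ∧≤Φ))
  ... | S , S⊆M , ∣S∣≡d , shattered = inside ∷ S , s⊆s S⊆M , cong suc ∣S∣≡d , shattered′
    where
    shattered′ : Shatters (Members F) (inside ∷ S)
    shattered′ (b ∷ T) T⊆S with shattered T (drop-∷-⊆ T⊆S)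
    ... | U , U∈∧ , T≡S∩U with ∧-true (F (inside ∷ U)) _ U∈∧ | b
    ...   | U∈F₁ , U∈F₀ | true  = inside  ∷ U , U∈F₁ , cong (inside ∷_) T≡S∩U
    ...   | U∈F₁ , U∈F₀ | false = outside ∷ U , U∈F₀ , cong (outside ∷_) T≡S∩U

  module _ {n : ℕ} (G : Graph n) where

    -- A set shattered by the traces on `M` lies inside `M`, where intersecting with `M` changes
    -- nothing, so the neighborhoods shatter it as well. Hence no d + 1 points are shattered by the
    -- traces.
    trace-bound : ∀ {d} → GraphVCDim≤ G d → (M : Subset n) (vs : List (Fin n)) →
                  AllPairs (λ u v → N G u ∩ M ≢ N G v ∩ M) vs → length vs ≤ suc ∣ M ∣ ^ suc d
    trace-bound {d} vc M vs distinct = begin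
      length vs             ≡⟨ length-map trace vs ⟨
      length (map trace vs) ≤⟨ length≤card traces _ (AllPairs.map⁺ distinct) (All.map⁺ (All.universal trace∈ vs)) ⟩
      card traces           ≤⟨ ≮⇒≥ not-more ⟩
      Φ (suc d) ∣ M ∣       ≤⟨ Φ≤ (suc d) ∣ M ∣ ⟩
      suc ∣ M ∣ ^ suc d     ∎
      where
      open ≤-Reasoning
      trace : Fin n → Subset n
      trace v = N G v ∩ M
      traces : Family n
      traces T = does (any? λ v → T ≟ˢ trace v)
      trace∈ : ∀ v → Members traces (trace v)
      trace∈ v with any? (λ u → trace v ≟ˢ trace u)
      ... | yes _  = refl
      ... | no ∄ = contradiction (v , refl) ∄
      ∈traces : ∀ T → Members traces T → ∃ λ v → T ≡ trace v
      ∈traces T T∈ with any? (λ v → T ≟ˢ trace v)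
      ... | yes w = w
      traces⊆M : ∀ T → Members traces T → T ⊆ M
      traces⊆M T T∈ with ∈traces T T∈
      ... | v , refl = p∩q⊆q (N G v) M
      not-more : ¬ Φ (suc d) ∣ M ∣ < card traces
      not-more Φ< with sauer-shelah (suc d) M traces traces⊆M Φ<
      ... | S , S⊆M , ∣S∣≡1+d , shattered = n≮n d (subst (_≤ d) ∣S∣≡1+d (vc S shattered′))
        where
        shattered′ : Shatters (Neighborhoods G) S
        shattered′ T T⊆S with shattered T T⊆S
        ... | U , U∈ , T≡S∩U with ∈traces U U∈
        ...   | v , U≡ = N G v , (v , refl) , trans T≡S∩U (trans (cong (S ∩_) U≡)
          (⊆-antisym (λ x∈ → let x∈S = p∩q⊆p S _ x∈ in x∈p∩q⁺ (x∈S , p∩q⊆p (N G v) M (p∩q⊆q S _ x∈)))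
                     (λ x∈ → let x∈S = p∩q⊆p S _ x∈ in x∈p∩q⁺ (x∈S , x∈p∩q⁺ (p∩q⊆q S _ x∈ , S⊆M x∈S)))))

  -- Packings of neighborhoods

  sum-mono : {f g : Fin n → ℕ} → (∀ i → f i ≤ g i) → sum f ≤ sum g
  sum-mono {zero}  f≤g = z≤n
  sum-mono {suc n} f≤g = +-mono-≤ (f≤g zero) (sum-mono (f≤g ∘ suc))

  sum-const : ∀ n c → ∑[ i < n ] c ≡ n * c
  sum-const zero    c = refl
  sum-const (suc n) c = cong (c +_) (sum-const n c)

  Fin⇒0< : Fin n → 0 < n
  Fin⇒0< {n} i = >-nonZero⁻¹ n {{nonZeroIndex i}}

  average-attained : 0 < n → (f : Fin n → ℕ) (c : ℕ) → n * c ≤ sum f → ∃ λ x → c ≤ f x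
  average-attained {n} 0<n f c nc≤∑f with any? (λ x → c ≤? f x)
  ... | yes w = w
  ... | no ∄  = contradiction nc≤∑f (<⇒≱ (begin-strict
    sum f                    <⟨ m<n+m (sum f) (subst (0 <_) (sym (*-identityʳ n)) 0<n) ⟩
    n * 1 + sum f            ≡⟨ cong (_+ sum f) (sum-const n 1) ⟨
    (∑[ x < n ] 1) + sum f   ≡⟨ ∑-distrib-+ (λ _ → 1) f ⟨
    ∑[ x < n ] suc (f x)     ≤⟨ sum-mono (λ x → ≰⇒> λ c≤ → ∄ (x , c≤)) ⟩
    ∑[ x < n ] c             ≡⟨ sum-const n c ⟩
    n * c                    ∎))
    where open ≤-Reasoning

  length-filterᵇ-∷ : (p : A → Bool) (x : A) (xs : List A) →
                     length (filterᵇ p (x ∷ xs)) ≡ ind (p x) + length (filterᵇ p xs)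
  length-filterᵇ-∷ p x xs with p x
  ... | true  = refl
  ... | false = refl

  length-filterᵇ-not : (p : A → Bool) (xs : List A) →
                       length (filterᵇ p xs) + length (filterᵇ (not ∘ p) xs) ≡ length xs
  length-filterᵇ-not p []       = refl
  length-filterᵇ-not p (x ∷ xs) with p x
  ... | true  = cong suc (length-filterᵇ-not p xs)
  ... | false = trans (+-suc _ _) (cong suc (length-filterᵇ-not p xs))

  All-filterᵇ-not : ∀ {Q : A → Set} (p : A → Bool) (xs : List A) → (∀ x → p x ≡ true → Q x) →
                    All Q (filterᵇ (not ∘ p) xs) → All Q xs
  All-filterᵇ-not p []       p⇒Q qs = []
  All-filterᵇ-not p (x ∷ xs) p⇒Q qs with p x in eq
  ... | true = p⇒Q x eq ∷ All-filterᵇ-not p xs p⇒Q qs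
  All-filterᵇ-not p (x ∷ xs) p⇒Q (q ∷ qs) | false = q ∷ All-filterᵇ-not p xs p⇒Q qs

  -- Lists each pair of positions once, earlier entry first, mirroring `AllPairs`, so that pairs can
  -- be filtered and counted.
  orderedPairs : List A → List (A × A)
  orderedPairs []       = []
  orderedPairs (x ∷ xs) = map (x ,_) xs ++ orderedPairs xs

  length-orderedPairs : (xs : List A) → length (orderedPairs xs) ≤ length xs * length xs
  length-orderedPairs []       = z≤n
  length-orderedPairs (x ∷ xs) = begin
    length (map (x ,_) xs ++ orderedPairs xs)      ≡⟨ length-++ (map (x ,_) xs) ⟩
    length (map (x ,_) xs) + length (orderedPairs xs) ≡⟨ cong (_+ _) (length-map (x ,_) xs) ⟩
    m + length (orderedPairs xs)                   ≤⟨ +-monoʳ-≤ m (length-orderedPairs xs) ⟩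
    m + m * m                                      ≡⟨ *-suc m m ⟨
    m * suc m                                      ≤⟨ *-monoˡ-≤ (suc m) (n≤1+n m) ⟩
    suc m * suc m                                  ∎
    where
    open ≤-Reasoning
    m = length xs

  AllPairs⇒All-orderedPairs : ∀ {R : A → A → Set} {xs} → AllPairs R xs → All (uncurry R) (orderedPairs xs)
  AllPairs⇒All-orderedPairs []         = []
  AllPairs⇒All-orderedPairs (rx ∷ rxs) = All.++⁺ (All.map⁺ rx) (AllPairs⇒All-orderedPairs rxs)

  All-orderedPairs⇒AllPairs : ∀ {R : A → A → Set} xs → All (uncurry R) (orderedPairs xs) → AllPairs R xs
  All-orderedPairs⇒AllPairs []       _ = []
  All-orderedPairs⇒AllPairs (x ∷ xs) r =
    All.map⁻ (All.++⁻ˡ (map (x ,_) xs) r) ∷ All-orderedPairs⇒AllPairs xs (All.++⁻ʳ (map (x ,_) xs) r)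

  -- The left side consists of the first two terms of the binomial expansion of the right side.
  bernoulli : ∀ b k → b ^ suc k + suc k * b ^ k ≤ suc b ^ suc k
  bernoulli b zero    = ≤-reflexive (lemma b)
    where
    lemma : ∀ b → b * 1 + 1 ≡ suc b * 1
    lemma = solve-∀
  bernoulli b (suc k) = begin
    b * (b * x) + suc (suc k) * (b * x)                  ≤⟨ m≤m+n _ (suc k * x) ⟩
    b * (b * x) + suc (suc k) * (b * x) + suc k * x      ≡⟨ lemma b k x ⟩
    suc b * (b * x + suc k * x)                          ≤⟨ *-monoʳ-≤ (suc b) (bernoulli b k) ⟩
    suc b * suc b ^ suc k                                ∎
    where
    open ≤-Reasoning
    x = b ^ k
    lemma : ∀ b k x → b * (b * x) + suc (suc k) * (b * x) + suc k * x ≡ suc b * (b * x + suc k * x)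
    lemma = solve-∀

  -- With a = b + 1 this is (1 - 1 / a) ^ a ≤ 1 / 2: the second binomial term already exceeds or
  -- equals the first.
  2*b^[1+b]≤[1+b]^[1+b] : ∀ b → 2 * b ^ suc b ≤ suc b ^ suc b
  2*b^[1+b]≤[1+b]^[1+b] b = begin
    2 * b ^ suc b                  ≡⟨ cong (b ^ suc b +_) (+-identityʳ _) ⟩
    b ^ suc b + b * b ^ b          ≤⟨ +-monoʳ-≤ (b ^ suc b) (*-monoˡ-≤ (b ^ b) (n≤1+n b)) ⟩
    b ^ suc b + suc b * b ^ b      ≤⟨ bernoulli b b ⟩
    suc b ^ suc b                  ∎
    where open ≤-Reasoning

  ^-distribʳ-* : ∀ x y k → (x * y) ^ k ≡ x ^ k * y ^ k
  ^-distribʳ-* x y zero    = refl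
  ^-distribʳ-* x y (suc k) = trans (cong (x * y *_) (^-distribʳ-* x y k)) (lemma x y (x ^ k) (y ^ k))
    where
    lemma : ∀ x y z w → x * y * (z * w) ≡ x * z * (y * w)
    lemma = solve-∀

  -- Every a = b + 1 rounds of shrinking by the factor b / a at least halve a quantity. There are j
  -- + 1 such blocks of rounds, one more than the factor 2 ^ j calls for, which makes the inequality
  -- strict.
  decay : ∀ b j → b ^ (suc b * suc j) * 2 ^ j < suc b ^ (suc b * suc j)
  decay b j = half (begin
    b ^ (a * suc j) * 2 ^ j * 2  ≡⟨ *-assoc (b ^ (a * suc j)) (2 ^ j) 2 ⟩
    b ^ (a * suc j) * (2 ^ j * 2) ≡⟨ cong (b ^ (a * suc j) *_) (*-comm (2 ^ j) 2) ⟩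
    b ^ (a * suc j) * 2 ^ suc j ≡⟨ cong (_* 2 ^ suc j) (^-*-assoc b a (suc j)) ⟨
    (b ^ a) ^ suc j * 2 ^ suc j ≡⟨ ^-distribʳ-* (b ^ a) 2 (suc j) ⟨
    (b ^ a * 2) ^ suc j         ≤⟨ ^-monoˡ-≤ (suc j) (subst (_≤ a ^ a) (*-comm 2 (b ^ a)) (2*b^[1+b]≤[1+b]^[1+b] b)) ⟩
    (a ^ a) ^ suc j             ≡⟨ ^-*-assoc a a (suc j) ⟩
    a ^ (a * suc j)             ∎) (m^n>0 a (a * suc j))
    where
    open ≤-Reasoning
    a = suc b
    half : ∀ {x y} → x * 2 ≤ y → 0 < y → x < y
    half {zero}  _   0<y = 0<y
    half {suc x} 2x≤y _ = <-≤-trans (subst (suc x <_) (*-comm 2 (suc x)) (m<m+n (suc x) z<s)) 2x≤y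

  ∣p∪q∣≤∣p∣+∣q∣ : (p q : Subset n) → ∣ p ∪ q ∣ ≤ ∣ p ∣ + ∣ q ∣
  ∣p∪q∣≤∣p∣+∣q∣ []          []          = z≤n
  ∣p∪q∣≤∣p∣+∣q∣ (false ∷ p) (false ∷ q) = ∣p∪q∣≤∣p∣+∣q∣ p q
  ∣p∪q∣≤∣p∣+∣q∣ (false ∷ p) (true  ∷ q) =
    ≤-trans (s≤s (∣p∪q∣≤∣p∣+∣q∣ p q)) (≤-reflexive (sym (+-suc ∣ p ∣ ∣ q ∣)))
  ∣p∪q∣≤∣p∣+∣q∣ (true  ∷ p) (b ∷ q)     =
    s≤s (≤-trans (∣p∪q∣≤∣p∣+∣q∣ p q) (+-monoʳ-≤ ∣ p ∣ (∣p∣≤∣x∷p∣ b q)))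

  module _ {n : ℕ} (G : Graph n) where
    open Graph G using (adj)

    differ : Fin n → Fin n × Fin n → Bool
    differ x (u , v) = adj u x xor adj v x

    dist : Fin n → Fin n → ℕ
    dist u v = ∑[ x < n ] ind (differ x (u , v))

    Far : ℕ → Fin n → Fin n → Set
    Far a u v = n ≤ a * dist u v

    Separated : Subset n → Fin n × Fin n → Set
    Separated M p = ∃ λ x → x ∈ M × differ x p ≡ true

    splits : Fin n → List (Fin n × Fin n) → ℕ
    splits x P = length (filterᵇ (differ x) P)

    -- Double counting: summed over all x, the numbers of split pairs give the total distance of the
    -- pairs, and each far pair contributes at least n / a.
    ∑splits : ∀ a P → All (uncurry (Far a)) P → n * length P ≤ a * (∑[ x < n ] splits x P)
    ∑splits a [] _ = ≤-trans (≤-reflexive (*-zeroʳ n)) z≤n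
    ∑splits a ((u , v) ∷ P) (far ∷ fars) = begin
      n * suc (length P)                                ≡⟨ *-suc n (length P) ⟩
      n + n * length P                                  ≤⟨ +-mono-≤ far (∑splits a P fars) ⟩
      a * dist u v + a * (∑[ x < n ] splits x P)        ≡⟨ *-distribˡ-+ a (dist u v) _ ⟨
      a * (dist u v + (∑[ x < n ] splits x P))          ≡⟨ cong (a *_) (∑-distrib-+ {n} (λ x → ind (differ x (u , v))) (λ x → splits x P)) ⟨
      a * (∑[ x < n ] (ind (differ x (u , v)) + splits x P)) ≡⟨ cong (a *_) (sum-cong-≗ (λ x → sym (length-filterᵇ-∷ (differ x) (u , v) P))) ⟩
      a * (∑[ x < n ] splits x ((u , v) ∷ P))           ∎
      where open ≤-Reasoning

    good-splitter : ∀ a P → All (uncurry (Far a)) P → 0 < n → ∃ λ x → length P ≤ a * splits x P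
    good-splitter a P fars 0<n = average-attained 0<n (λ x → a * splits x P) (length P)
      (≤-trans (∑splits a P fars) (≤-reflexive (*-distribˡ-sum a (λ x → splits x P))))

    -- Some vertex x splits at least a 1 / (b + 1) fraction of the pairs; putting
    -- x into M leaves at most b / (b + 1) of them unseparated.
    separate : ∀ b t P → All (uncurry (Far (suc b))) P → b ^ t * length P < suc b ^ t →
               ∃ λ M → ∣ M ∣ ≤ t × All (Separated M) P
    separate b t []          fars small = ⊥ , subst (_≤ t) (sym (∣⊥∣≡0 n)) z≤n , []
    -- With no rounds left, the hypothesis says that fewer than one pair remains.
    separate b zero (_ ∷ _)  fars (s≤s ())
    separate b (suc t) P@((u , _) ∷ _) fars small with good-splitter (suc b) P fars (Fin⇒0< u)
    ... | x , ∣P∣≤ with separate b t P′ (All.filter⁺ (T? ∘ not ∘ differ x) fars) smaller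
      where
      P′ : List (Fin n × Fin n)
      P′ = filterᵇ (not ∘ differ x) P
      open ≤-Reasoning
      -- Split and unsplit pairs make up `P`, and the split ones, taken b + 1 times, already cover
      -- `length P`; cancelling it leaves b copies.
      a∣P′∣≤b∣P∣ : suc b * length P′ ≤ b * length P
      a∣P′∣≤b∣P∣ = +-cancelˡ-≤ (length P) _ _ (begin
        length P + suc b * length P′            ≤⟨ +-monoˡ-≤ _ ∣P∣≤ ⟩
        suc b * splits x P + suc b * length P′  ≡⟨ *-distribˡ-+ (suc b) (splits x P) _ ⟨
        suc b * (splits x P + length P′)        ≡⟨ cong (suc b *_) (length-filterᵇ-not (differ x) P) ⟩
        suc b * length P                        ∎)
      smaller : b ^ t * length P′ < suc b ^ t
      smaller = *-cancelˡ-< (suc b) _ _ (begin-strict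
        suc b * (b ^ t * length P′)  ≡⟨ lemma (suc b) (b ^ t) (length P′) ⟩
        b ^ t * (suc b * length P′)  ≤⟨ *-monoʳ-≤ (b ^ t) a∣P′∣≤b∣P∣ ⟩
        b ^ t * (b * length P)       ≡⟨ lemma′ (b ^ t) b (length P) ⟩
        b * b ^ t * length P         <⟨ small ⟩
        suc b * suc b ^ t            ∎)
        where
        lemma : ∀ x y z → x * (y * z) ≡ y * (x * z)
        lemma = solve-∀
        lemma′ : ∀ x y z → x * (y * z) ≡ y * x * z
        lemma′ = solve-∀
    ... | M , ∣M∣≤t , separated = M ∪ ⁅ x ⁆ , ∣M∪x∣≤ ,
      All-filterᵇ-not (differ x) P (λ p split → x , x∈p∪q⁺ (inj₂ (x∈⁅x⁆ x)) , split)
        (All.map (λ (y , y∈M , split) → y , x∈p∪q⁺ (inj₁ y∈M) , split) separated)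
      where
      open ≤-Reasoning
      ∣M∪x∣≤ : ∣ M ∪ ⁅ x ⁆ ∣ ≤ suc t
      ∣M∪x∣≤ = begin
        ∣ M ∪ ⁅ x ⁆ ∣     ≤⟨ ∣p∪q∣≤∣p∣+∣q∣ M ⁅ x ⁆ ⟩
        ∣ M ∣ + ∣ ⁅ x ⁆ ∣ ≡⟨ cong (∣ M ∣ +_) (∣⁅x⁆∣≡1 x) ⟩
        ∣ M ∣ + 1         ≡⟨ +-comm ∣ M ∣ 1 ⟩
        suc ∣ M ∣         ≤⟨ s≤s ∣M∣≤t ⟩
        suc t             ∎

    Separated⇒≢ : ∀ {M u v} → Separated M (u , v) → N G u ∩ M ≢ N G v ∩ M
    Separated⇒≢ {M} {u} {v} (x , x∈M , split) eq = case trans (sym split) u≡v of λ ()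
      where
      open ≡-Reasoning
      trace : ∀ w → Vec.lookup (N G w ∩ M) x ≡ adj w x
      trace w = begin
        Vec.lookup (N G w ∩ M) x           ≡⟨ lookup-zipWith _∧_ x (N G w) M ⟩
        Vec.lookup (N G w) x ∧ Vec.lookup M x  ≡⟨ cong₂ _∧_ (lookup∘tabulate (adj w) x) ([]=⇒lookup x∈M) ⟩
        adj w x ∧ true                 ≡⟨ ∧-identityʳ (adj w x) ⟩
        adj w x                        ∎
      u≡v : adj u x xor adj v x ≡ false
      u≡v = begin
        adj u x xor adj v x  ≡⟨ cong (_xor adj v x) (trans (sym (trace u)) (trans (cong (λ S → Vec.lookup S x) eq) (trace v))) ⟩
        adj v x xor adj v x  ≡⟨ xor-same (adj v x) ⟩
        false                ∎

  n<2^n : ∀ k → k < 2 ^ k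
  n<2^n zero    = z<s
  n<2^n (suc k) = ≤-trans (+-mono-≤ (m^n>0 2 k) (n<2^n k)) (≤-reflexive (cong (2 ^ k +_) (sym (+-identityʳ (2 ^ k)))))

  -- Chosen so that 2 ^ L outgrows (a (2 L + 1) + 1) ^ e: with u = 6 e + a, the summand 6 e yields 2
  -- L ≤ u², and the factor 3 e is the exponent of the resulting power of u + 1.
  packingLog : ℕ → ℕ → ℕ
  packingLog e a = 3 * e * (6 * e + a)

  -- With u = 6 e + a and L = 3 e u, the base is less than (u + 1)³ ≤ 2 ^ (3 u).
  packingLog-large : ∀ d a → 0 < a → suc (a * suc (packingLog (suc d) a + packingLog (suc d) a)) ^ suc d < 2 ^ packingLog (suc d) a
  packingLog-large d a@(suc _) 0<a = begin-strict
    suc (a * suc (L + L)) ^ e            ≤⟨ ^-monoˡ-≤ e (s≤s (*-mono-≤ (m≤n+m a (6 * e)) (s≤s (≤-trans (≤-reflexive (lemma₁ e u)) (*-monoˡ-≤ u (m≤m+n (6 * e) a)))))) ⟩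
    suc (u * suc (u * u)) ^ e            <⟨ ^-monoˡ-< e (≤-trans (m<m+n _ (≤-trans 0<u (≤-trans (m≤m+n u _) (m≤n+m _ (3 * u * u))))) (≤-reflexive (lemma₂ u))) ⟩
    (suc u ^ 3) ^ e                      ≤⟨ ^-monoˡ-≤ e (^-monoˡ-≤ 3 (n<2^n u)) ⟩
    ((2 ^ u) ^ 3) ^ e                    ≡⟨ cong (_^ e) (^-*-assoc 2 u 3) ⟩
    (2 ^ (u * 3)) ^ e                    ≡⟨ ^-*-assoc 2 (u * 3) e ⟩
    2 ^ (u * 3 * e)                      ≡⟨ cong (2 ^_) (lemma₃ u e) ⟩
    2 ^ L                                ∎
    where
    open ≤-Reasoning
    e = suc d
    u = 6 * e + a
    L = 3 * e * u
    0<u : 0 < u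
    0<u = ≤-trans 0<a (m≤n+m a (6 * e))
    lemma₁ : ∀ e u → 3 * e * u + 3 * e * u ≡ 6 * e * u
    lemma₁ = solve-∀
    lemma₂ : ∀ u → suc (u * suc (u * u)) + (3 * u * u + (u + u)) ≡ suc u * (suc u * (suc u * 1))
    lemma₂ = solve-∀
    lemma₃ : ∀ u e → u * 3 * e ≡ 3 * e * u
    lemma₃ = solve-∀

  module _ {n : ℕ} (G : Graph n) where

    -- A longer list is cut down to exactly 2 ^ L vertices. Their traces on the separating set are
    -- distinct, and `trace-bound` then contradicts `packingLog-large`.
    packing-bound : ∀ {d} → GraphVCDim≤ G d → ∀ a → 0 < a → ∀ vs → AllPairs (Far G a) vs →
                    length vs < 2 ^ packingLog (suc d) a
    packing-bound {d} vc a@(suc b) 0<a vs far = ≰⇒> λ 2^L≤ → contradiction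
      (bound (take (2 ^ L) vs) (AllPairs.take⁺ (2 ^ L) far) (trans (length-take (2 ^ L) vs) (m≤n⇒m⊓n≡m 2^L≤)))
      (<⇒≱ (packingLog-large d a 0<a))
      where
      open ≤-Reasoning
      L = packingLog (suc d) a
      -- Enough rounds for `decay` to exhaust the at most 2 ^ (2 L) pairs.
      t = a * suc (L + L)
      bound : ∀ us → AllPairs (Far G a) us → length us ≡ 2 ^ L → 2 ^ L ≤ suc t ^ suc d
      bound us far ∣us∣≡ with separate G b t (orderedPairs us) (AllPairs⇒All-orderedPairs far) (begin-strict
        b ^ t * length (orderedPairs us)   ≤⟨ *-monoʳ-≤ (b ^ t) (length-orderedPairs us) ⟩
        b ^ t * (length us * length us)    ≡⟨ cong (λ l → b ^ t * (l * l)) ∣us∣≡ ⟩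
        b ^ t * (2 ^ L * 2 ^ L)            ≡⟨ cong (b ^ t *_) (^-distribˡ-+-* 2 L L) ⟨
        b ^ t * 2 ^ (L + L)                <⟨ decay b (L + L) ⟩
        a ^ t                              ∎)
      ... | M , ∣M∣≤t , separated = begin
        2 ^ L                ≡⟨ ∣us∣≡ ⟨
        length us            ≤⟨ trace-bound G vc M us (AllPairs.map (Separated⇒≢ G) (All-orderedPairs⇒AllPairs us separated)) ⟩
        suc ∣ M ∣ ^ suc d    ≤⟨ ^-monoˡ-≤ (suc d) (s≤s ∣M∣≤t) ⟩
        suc t ^ suc d        ∎

  -- Counting over the blocks of a partition

  -- Parts must be nonempty, so labels that are never attained are punched out one at a time; the
  -- classes remain fine enough to determine `f`.
  surjective-part : ∀ {k n} (f : Fin n → Fin k) →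
    ∃ λ K → K ≤ k × Σ (Fin n → Fin K) λ g → Surjective _≡_ _≡_ g × (∀ x y → g x ≡ g y → f x ≡ f y)
  surjective-part {zero}  f = 0 , z≤n , f , (λ ()) , λ _ _ eq → eq
  surjective-part {suc k} f with all? (λ i → any? (λ x → f x ≟ i))
  ... | yes hit = suc k , ≤-refl , f , (λ i → let x , fx≡i = hit i in x , λ { refl → fx≡i }) , λ _ _ eq → eq
  ... | no ¬hit with ¬∀⟶∃¬ _ _ (λ i → any? (λ x → f x ≟ i)) ¬hit
  ...   | i , i∉f = let K , K≤k , g , g-onto , g⇒f = surjective-part (λ x → punchOut (i≢f x)) in
    K , m≤n⇒m≤1+n K≤k , g , g-onto , λ x y eq → punchOut-injective (i≢f x) (i≢f y) (g⇒f x y eq)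
    where
    i≢f : ∀ x → i ≢ f x
    i≢f x i≡fx = i∉f (x , sym i≡fx)

  ind-∧ : ∀ a b → ind (a ∧ b) ≡ ind a * ind b
  ind-∧ true  b = sym (+-identityʳ (ind b))
  ind-∧ false b = refl

  ind-not : ∀ b → ind b + ind (not b) ≡ 1
  ind-not true  = refl
  ind-not false = refl

  ∣tabulate∣ : (f : Fin n → Bool) → ∣ Vec.tabulate f ∣ ≡ ∑[ x < n ] ind (f x)
  ∣tabulate∣ {zero}  f = refl
  ∣tabulate∣ {suc n} f with f zero
  ... | true  = cong suc (∣tabulate∣ (f ∘ suc))
  ... | false = ∣tabulate∣ (f ∘ suc)

  does-∈? : (x : Fin n) (p : Subset n) → does (x ∈? p) ≡ Vec.lookup p x
  does-∈? zero    (true  Vec.∷ p) = refl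
  does-∈? zero    (false Vec.∷ p) = refl
  does-∈? (suc x) (_ Vec.∷ p)     = does-∈? x p

  module _ {A : Set} {P : Pred A 0ℓ} (P? : Decidable P) where

    length-filter-tabulate : (f : Fin n → A) → length (filter P? (tabulate f)) ≡ ∑[ x < n ] ind (does (P? (f x)))
    length-filter-tabulate {zero}  f = refl
    length-filter-tabulate {suc n} f with does (P? (f zero))
    ... | true  = cong suc (length-filter-tabulate (f ∘ suc))
    ... | false = length-filter-tabulate (f ∘ suc)

  module _ {A B : Set} {P : Pred (A × B) 0ℓ} (P? : Decidable P) where

    -- Turns the list counts in `edgePairs` and `MostPairs` into double sums, which can be exchanged
    -- and split into blocks.
    length-filter-product : ∀ {m n} (f : Fin m → A) (g : Fin n → B) →
      length (filter P? (cartesianProduct (tabulate f) (tabulate g))) ≡ ∑[ x < m ] ∑[ y < n ] ind (does (P? (f x , g y)))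
    length-filter-product {zero}      f g = refl
    length-filter-product {suc m} {n} f g = begin
      length (filter P? (map (f zero ,_) (tabulate g) ++ rest))
        ≡⟨ cong length (filter-++ P? (map (f zero ,_) (tabulate g)) rest) ⟩
      length (filter P? (map (f zero ,_) (tabulate g)) ++ filter P? rest)
        ≡⟨ length-++ (filter P? (map (f zero ,_) (tabulate g))) ⟩
      length (filter P? (map (f zero ,_) (tabulate g))) + length (filter P? rest)
        ≡⟨ cong₂ _+_ (trans (cong (length ∘ filter P?) (map-tabulate g (f zero ,_))) (length-filter-tabulate P? (λ y → f zero , g y)))
                     (length-filter-product (f ∘ suc) g) ⟩
      ∑[ x < suc m ] ∑[ y < n ] ind (does (P? (f x , g y))) ∎
      where
      open ≡-Reasoning
      rest = cartesianProduct (tabulate (f ∘ suc)) (tabulate g)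

  ∑₂-cong : ∀ {m} {F F′ : Fin m → Fin n → ℕ} → (∀ x y → F x y ≡ F′ x y) →
            ∑[ x < m ] ∑[ y < n ] F x y ≡ ∑[ x < m ] ∑[ y < n ] F′ x y
  ∑₂-cong F≡F′ = sum-cong-≗ (λ x → sum-cong-≗ (F≡F′ x))

  ∑₂-mono : ∀ {m} {F F′ : Fin m → Fin n → ℕ} → (∀ x y → F x y ≤ F′ x y) →
            ∑[ x < m ] ∑[ y < n ] F x y ≤ ∑[ x < m ] ∑[ y < n ] F′ x y
  ∑₂-mono F≤F′ = sum-mono (λ x → sum-mono (F≤F′ x))

  ∑₂-+ : ∀ {m} (F F′ : Fin m → Fin n → ℕ) →
         ∑[ x < m ] ∑[ y < n ] (F x y + F′ x y) ≡ (∑[ x < m ] ∑[ y < n ] F x y) + (∑[ x < m ] ∑[ y < n ] F′ x y)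
  ∑₂-+ F F′ = trans (sum-cong-≗ (λ x → ∑-distrib-+ (F x) (F′ x))) (∑-distrib-+ (λ x → sum (F x)) (λ x → sum (F′ x)))

  ∑₂-*ˡ : ∀ {m} c (F : Fin m → Fin n → ℕ) →
          c * (∑[ x < m ] ∑[ y < n ] F x y) ≡ ∑[ x < m ] ∑[ y < n ] (c * F x y)
  ∑₂-*ˡ c F = trans (*-distribˡ-sum c (λ x → sum (F x))) (sum-cong-≗ (λ x → *-distribˡ-sum c (F x)))

  ∑-indicator : (i : Fin n) (f : Fin n → ℕ) → ∑[ j < n ] (ind ⌊ i ≟ j ⌋ * f j) ≡ f i
  ∑-indicator {suc n} zero f = begin
    f zero + 0 + (∑[ j < n ] 0)  ≡⟨ cong₂ _+_ (+-identityʳ (f zero)) (trans (sum-const n 0) (*-zeroʳ n)) ⟩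
    f zero + 0                   ≡⟨ +-identityʳ (f zero) ⟩
    f zero                       ∎
    where open ≡-Reasoning
  ∑-indicator {suc n} (suc i) f = trans (sum-cong-≗ shift) (∑-indicator i (f ∘ suc))
    where
    shift : ∀ j → ind ⌊ suc i ≟ suc j ⌋ * f (suc j) ≡ ind ⌊ i ≟ j ⌋ * f (suc j)
    shift j with i ≟ j
    ... | yes _ = refl
    ... | no _  = refl

  module Blocks {n K : ℕ} (part : Fin n → Fin K) where

    χ : Fin K → Fin n → ℕ
    χ i x = ind ⌊ part x ≟ i ⌋

    size : Fin K → ℕ
    size i = ∑[ x < n ] χ i x

    block : (Fin n → Fin n → ℕ) → Fin K → Fin K → ℕ
    block F i j = ∑[ x < n ] ∑[ y < n ] (χ i x * (χ j y * F x y))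

    ∑-fibers : (f : Fin n → ℕ) → ∑[ x < n ] f x ≡ ∑[ i < K ] ∑[ x < n ] (χ i x * f x)
    ∑-fibers f = trans (sum-cong-≗ (λ x → sym (∑-indicator (part x) (λ _ → f x))))
                       (∑-comm (λ x i → χ i x * f x))

    -- Every vertex lies in exactly one fiber, so the indicators `χ` can be inserted first for y and
    -- then for x.
    ∑-block : (F : Fin n → Fin n → ℕ) → ∑[ x < n ] ∑[ y < n ] F x y ≡ ∑[ i < K ] ∑[ j < K ] block F i j
    ∑-block F = begin
      ∑[ x < n ] ∑[ y < n ] F x y
        ≡⟨ sum-cong-≗ (λ x → ∑-fibers (F x)) ⟩
      ∑[ x < n ] ∑[ j < K ] ∑[ y < n ] (χ j y * F x y)
        ≡⟨ ∑-fibers (λ x → ∑[ j < K ] ∑[ y < n ] (χ j y * F x y)) ⟩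
      ∑[ i < K ] ∑[ x < n ] (χ i x * (∑[ j < K ] ∑[ y < n ] (χ j y * F x y)))
        ≡⟨ ∑₂-cong (λ i x → ∑₂-*ˡ (χ i x) (λ j y → χ j y * F x y)) ⟩
      ∑[ i < K ] ∑[ x < n ] ∑[ j < K ] ∑[ y < n ] (χ i x * (χ j y * F x y))
        ≡⟨ sum-cong-≗ (λ i → ∑-comm (λ x j → ∑[ y < n ] (χ i x * (χ j y * F x y)))) ⟩
      ∑[ i < K ] ∑[ j < K ] block F i j ∎
      where open ≡-Reasoning

    block-mono : ∀ {F F′} i j → (∀ x y → part x ≡ i → part y ≡ j → F x y ≤ F′ x y) → block F i j ≤ block F′ i j
    block-mono {F} {F′} i j F≤F′ = ∑₂-mono pointwise
      where
      pointwise : ∀ x y → χ i x * (χ j y * F x y) ≤ χ i x * (χ j y * F′ x y)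
      pointwise x y with part x ≟ i | part y ≟ j
      ... | no _    | _       = z≤n
      ... | yes _   | no _    = z≤n
      ... | yes x∈i | yes y∈j = *-monoʳ-≤ 1 (*-monoʳ-≤ 1 (F≤F′ x y x∈i y∈j))

    block-+ : ∀ F F′ i j → block (λ x y → F x y + F′ x y) i j ≡ block F i j + block F′ i j
    block-+ F F′ i j = trans (∑₂-cong (λ x y → lemma (χ i x) (χ j y) (F x y) (F′ x y)))
                             (∑₂-+ (λ x y → χ i x * (χ j y * F x y)) (λ x y → χ i x * (χ j y * F′ x y)))
      where
      lemma : ∀ a b c d → a * (b * (c + d)) ≡ a * (b * c) + a * (b * d)
      lemma = solve-∀

    block-const : ∀ c i j → block (λ _ _ → c) i j ≡ c * (size i * size j)
    block-const c i j = begin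
      ∑[ x < n ] ∑[ y < n ] (χ i x * (χ j y * c))  ≡⟨ ∑₂-cong (λ x y → lemma (χ i x) (χ j y) c) ⟩
      ∑[ x < n ] ∑[ y < n ] (c * (χ i x * χ j y))  ≡⟨ ∑₂-*ˡ c (λ x y → χ i x * χ j y) ⟨
      c * (∑[ x < n ] ∑[ y < n ] (χ i x * χ j y))  ≡⟨ cong (c *_) (sum-cong-≗ (λ x → *-distribˡ-sum (χ i x) (χ j))) ⟨
      c * (∑[ x < n ] (χ i x * size j))            ≡⟨ cong (c *_) (*-distribʳ-sum (size j) (χ i)) ⟨
      c * (size i * size j)                        ∎
      where
      open ≡-Reasoning
      lemma : ∀ a b c → a * (b * c) ≡ c * (a * b)
      lemma = solve-∀

    -- For `F` the indicator of an error, the fraction of errors in the block is at most 1 / a.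
    Uniform : ℕ → (Fin n → Fin n → ℕ) → Fin K → Fin K → Set
    Uniform a F i j = a * block F i j ≤ size i * size j

    uniform? : ∀ a F i j → Dec (Uniform a F i j)
    uniform? a F i j = a * block F i j ≤? size i * size j

    -- Markov's inequality, block by block: a nonuniform block has fewer pairs than a times its
    -- share of `F`, and a uniform block adds nothing on the left.
    ∑-nonuniform : ∀ a F → ∑[ x < n ] ∑[ y < n ] ind (not ⌊ uniform? a F (part x) (part y) ⌋)
                         ≤ a * (∑[ x < n ] ∑[ y < n ] F x y)
    ∑-nonuniform a F = begin
      ∑[ x < n ] ∑[ y < n ] h (part x) (part y)               ≡⟨ ∑-block (λ x y → h (part x) (part y)) ⟩
      ∑[ i < K ] ∑[ j < K ] block (λ x y → h (part x) (part y)) i j ≤⟨ ∑₂-mono bound ⟩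
      ∑[ i < K ] ∑[ j < K ] (a * block F i j)                 ≡⟨ ∑₂-*ˡ a (block F) ⟨
      a * (∑[ i < K ] ∑[ j < K ] block F i j)                 ≡⟨ cong (a *_) (∑-block F) ⟨
      a * (∑[ x < n ] ∑[ y < n ] F x y)                       ∎
      where
      open ≤-Reasoning
      h : Fin K → Fin K → ℕ
      h i j = ind (not ⌊ uniform? a F i j ⌋)
      h≤ : ∀ i j → h i j * (size i * size j) ≤ a * block F i j
      h≤ i j with uniform? a F i j
      ... | yes _ = z≤n
      ... | no ¬u = subst (_≤ a * block F i j) (sym (+-identityʳ _)) (<⇒≤ (≰⇒> ¬u))
      bound : ∀ i j → block (λ x y → h (part x) (part y)) i j ≤ a * block F i j
      bound i j = begin
        block (λ x y → h (part x) (part y)) i j  ≤⟨ block-mono i j (λ { x y refl refl → ≤-refl }) ⟩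
        block (λ _ _ → h i j) i j                ≡⟨ block-const (h i j) i j ⟩
        h i j * (size i * size j)                ≤⟨ h≤ i j ⟩
        a * block F i j                          ∎

  -- Regularity over the natural numbers, for ε = 1 / (b + 1)

  module _ {n : ℕ} (G : Graph n) where
    open Graph G using (adj)

    dist-self : ∀ x → dist G x x ≡ 0
    dist-self x = trans (sum-cong-≗ (λ y → cong ind (xor-same (adj x y)))) (trans (sum-const n 0) (*-zeroʳ n))

    -- Greedy choice along the list: a vertex joins unless it is near a member. Once it has joined
    -- it is near itself, its distance to itself being 0 and n being positive.
    maximal-packing : ∀ a (xs : List (Fin n)) →
      ∃ λ R → AllPairs (Far G a) R × All (λ x → Any (λ r → a * dist G x r < n) R) xs
    maximal-packing a []       = [] , [] , []
    maximal-packing a (x ∷ xs) with maximal-packing a xs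
    ... | R , far , near with Any.any? (λ r → a * dist G x r <? n) R
    ...   | yes x-near = R , far , x-near ∷ near
    ...   | no ¬x-near = x ∷ R , All.map ≮⇒≥ (All.¬Any⇒All¬ R ¬x-near) ∷ far , here x-near-x ∷ All.map there near
      where
      x-near-x : a * dist G x x < n
      x-near-x = subst (_< n) (sym (trans (cong (a *_) (dist-self x)) (*-zeroʳ a))) (Fin⇒0< x)

    edgePairs-cells : ∀ {K} (𝒫 : Partition n K) → let open Partition 𝒫 in ∀ i j →
      edgePairs G (cell i) (cell j) ≡ Blocks.block part (λ x y → ind (adj x y)) i j
    edgePairs-cells 𝒫 i j = trans (length-filter-product (λ (x , y) → (x ∈? cell i) ×-dec ((y ∈? cell j) ×-dec T? (adj x y))) id id) (∑₂-cong pointwise)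
      where
      open Partition 𝒫
      open ≡-Reasoning
      does-∈cell : ∀ i x → does (x ∈? cell i) ≡ ⌊ part x ≟ i ⌋
      does-∈cell i x = trans (does-∈? x (cell i)) (lookup∘tabulate _ x)
      pointwise : ∀ x y → ind (does ((x ∈? cell i) ×-dec ((y ∈? cell j) ×-dec T? (adj x y)))) ≡
                          ind ⌊ part x ≟ i ⌋ * (ind ⌊ part y ≟ j ⌋ * ind (adj x y))
      pointwise x y = begin
        ind (does (x ∈? cell i) ∧ (does (y ∈? cell j) ∧ adj x y))
          ≡⟨ cong₂ (λ a b → ind (a ∧ (b ∧ adj x y))) (does-∈cell i x) (does-∈cell j y) ⟩
        ind (⌊ part x ≟ i ⌋ ∧ (⌊ part y ≟ j ⌋ ∧ adj x y))
          ≡⟨ trans (ind-∧ ⌊ part x ≟ i ⌋ _) (cong (ind ⌊ part x ≟ i ⌋ *_) (ind-∧ ⌊ part y ≟ j ⌋ _)) ⟩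
        ind ⌊ part x ≟ i ⌋ * (ind ⌊ part y ≟ j ⌋ * ind (adj x y)) ∎

    pairCount : (Fin n → Fin n → Bool) → ℕ
    pairCount H = length (filterᵇ (λ (x , y) → H x y) (allPairs n))

    -- Homogeneity for ε = 1 / (b + 1), with denominators cleared.
    NatHomogeneous : ℕ → Subset n → Subset n → Set
    NatHomogeneous b X Y =
      suc b * edgePairs G X Y ≤ ∣ X ∣ * ∣ Y ∣
      ⊎ b * (∣ X ∣ * ∣ Y ∣) ≤ suc b * edgePairs G X Y × edgePairs G X Y ≤ ∣ X ∣ * ∣ Y ∣

    module _ {K : ℕ} (𝒫 : Partition n K) (f : Fin n → Fin n → Bool)
             (f-const : ∀ x x′ y y′ → Partition.part 𝒫 x ≡ Partition.part 𝒫 x′ →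
                                      Partition.part 𝒫 y ≡ Partition.part 𝒫 y′ → f x y ≡ f x′ y′) where
      open Partition 𝒫
      open Blocks part

      private
        err edge : Fin n → Fin n → ℕ
        err  x y = ind (adj x y xor f x y)
        edge x y = ind (adj x y)

      -- `f` is constant on the block. If it is false there, every edge is an error, so edges are
      -- few; if it is true, every non-edge is an error, so non-edges are few.
      uniform⇒homogeneous : ∀ b x y → Uniform (suc b) err (part x) (part y) →
                            NatHomogeneous b (cell (part x)) (cell (part y))
      uniform⇒homogeneous b x y uniform
        rewrite edgePairs-cells 𝒫 (part x) (part y)
              | ∣tabulate∣ (λ z → ⌊ part z ≟ part x ⌋) | ∣tabulate∣ (λ z → ⌊ part z ≟ part y ⌋)
        with f x y in fxy
      ... | false = inj₁ (≤-trans (*-monoʳ-≤ (suc b) (block-mono {edge} {err} (part x) (part y) edge≤err)) uniform)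
        where
        edge≤err : ∀ x′ y′ → part x′ ≡ part x → part y′ ≡ part y → edge x′ y′ ≤ err x′ y′
        edge≤err x′ y′ px py rewrite trans (f-const x′ x y′ y px py) fxy with adj x′ y′
        ... | true  = ≤-refl
        ... | false = z≤n
      ... | true = inj₂ (+-cancelˡ-≤ s _ _ (begin
        suc b * s                                  ≡⟨ cong (suc b *_) block-1 ⟨
        suc b * block (λ _ _ → 1) i j              ≤⟨ *-monoʳ-≤ (suc b) (block-mono i j 1≤err+edge) ⟩
        suc b * block (λ x y → err x y + edge x y) i j ≡⟨ cong (suc b *_) (block-+ err edge i j) ⟩
        suc b * (block err i j + block edge i j)   ≡⟨ *-distribˡ-+ (suc b) (block err i j) _ ⟩
        suc b * block err i j + suc b * block edge i j ≤⟨ +-monoˡ-≤ _ uniform ⟩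
        s + suc b * block edge i j                 ∎)
        , ≤-trans (block-mono i j (λ x y _ _ → ind≤1 (adj x y))) (≤-reflexive block-1))
        where
        open ≤-Reasoning
        i = part x
        j = part y
        s = size i * size j
        block-1 : block (λ _ _ → 1) i j ≡ s
        block-1 = trans (block-const 1 i j) (+-identityʳ s)
        ind≤1 : ∀ a → ind a ≤ 1
        ind≤1 true  = ≤-refl
        ind≤1 false = z≤n
        1≤err+edge : ∀ x′ y′ → part x′ ≡ i → part y′ ≡ j → 1 ≤ err x′ y′ + edge x′ y′
        1≤err+edge x′ y′ px py rewrite trans (f-const x′ x y′ y px py) fxy with adj x′ y′
        ... | true  = ≤-refl
        ... | false = ≤-refl

      -- Both factors of a = (b + 1)² are used: one by Markov's inequality at threshold 1 / (b + 1),
      -- the other to bring the nonuniform pairs down to n² / (b + 1).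
      most-uniform : ∀ b → suc b * (suc b * (∑[ x < n ] ∑[ y < n ] err x y)) ≤ n * n →
        b * (n * n) ≤ suc b * pairCount (λ x y → ⌊ uniform? (suc b) err (part x) (part y) ⌋)
      most-uniform b few-errors = +-cancelʳ-≤ (n * n) _ _ (begin
        b * (n * n) + n * n                ≡⟨ +-comm (b * (n * n)) (n * n) ⟩
        suc b * (n * n)                    ≡⟨ cong (suc b *_) (trans (sum-cong-≗ {n} (λ _ → trans (sum-const n 1) (*-identityʳ n))) (sum-const n n)) ⟨
        suc b * (∑[ x < n ] ∑[ y < n ] 1)  ≡⟨ cong (suc b *_) (trans (sym (∑₂-+ (λ x y → ind (u x y)) (λ x y → ind (not (u x y))))) (∑₂-cong (λ x y → ind-not (u x y)))) ⟨
        suc b * (good + bad)               ≡⟨ *-distribˡ-+ (suc b) good bad ⟩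
        suc b * good + suc b * bad         ≤⟨ +-monoʳ-≤ (suc b * good) (≤-trans (*-monoʳ-≤ (suc b) (∑-nonuniform (suc b) err)) few-errors) ⟩
        suc b * good + n * n               ≡⟨ cong (λ c → suc b * c + n * n) (length-filter-product (λ (x , y) → T? (u x y)) id id) ⟨
        suc b * pairCount u + n * n ∎)
        where
        open ≤-Reasoning
        u : Fin n → Fin n → Bool
        u x y = ⌊ uniform? (suc b) err (part x) (part y) ⌋
        good bad : ℕ
        good = ∑[ x < n ] ∑[ y < n ] ind (u x y)
        bad  = ∑[ x < n ] ∑[ y < n ] ind (not (u x y))

  bit : Bool → Fin 2
  bit false = zero
  bit true  = suc zero

  bit-injective : ∀ {a b} → bit a ≡ bit b → a ≡ b
  bit-injective {false} {false} _ = refl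
  bit-injective {true}  {true}  _ = refl

  module _ {n : ℕ} (G : Graph n) where
    open Graph G using (adj)

    nat-regularity : ∀ {d} → GraphVCDim≤ G d → ∀ b →
      ∃ λ K → K ≤ 2 ^ (2 ^ suc (packingLog (suc d) (suc b * suc b))) ×
      Σ (Partition n K) λ 𝒫 → let open Partition 𝒫 in
      Σ (Fin n → Fin n → Bool) λ H →
        (∀ x y → T (H x y) → NatHomogeneous G b (cell (part x)) (cell (part y))) ×
        b * (n * n) ≤ suc b * pairCount G H
    nat-regularity {d} vc b with maximal-packing G (suc b * suc b) (allFin n)
    ... | R , far , near = K , K≤2^2^ , 𝒫 , H , H⇒homogeneous , most-uniform G 𝒫 approx approx-const b few-errors
      where
      open ≤-Reasoning
      m = length R
      L = packingLog (suc d) (suc b * suc b)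
      x-near : ∀ x → Any (λ r → suc b * suc b * dist G x r < n) R
      x-near x = All.lookup near (∈-allFin x)
      centre : Fin n → Fin m
      centre x = index (x-near x)
      -- The first component fixes the row `approx x`, the second fixes every entry in column y;
      -- together they make `approx` constant on blocks.
      key : Fin n → Fin (m * 2 ^ m)
      key x = combine (centre x) (funToFin (λ i → bit (adj (lookup R i) x)))
      key-centre : ∀ x y → key x ≡ key y → centre x ≡ centre y
      key-centre x y eq = proj₁ (combine-injective (centre x) _ (centre y) _ eq)
      key-adj : ∀ x y → key x ≡ key y → ∀ i → adj (lookup R i) x ≡ adj (lookup R i) y
      key-adj x y eq i = bit-injective (trans (sym (finToFun-funToFin _ i))
        (trans (cong (λ c → finToFun c i) (proj₂ (combine-injective (centre x) _ (centre y) _ eq))) (finToFun-funToFin _ i)))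
      quotient = surjective-part key
      K = proj₁ quotient
      𝒫 : Partition n K
      𝒫 = record { part = proj₁ (proj₂ (proj₂ quotient)) ; surjective = proj₁ (proj₂ (proj₂ (proj₂ quotient))) }
      open Partition 𝒫 using (part; cell)
      part⇒key : ∀ x y → part x ≡ part y → key x ≡ key y
      part⇒key = proj₂ (proj₂ (proj₂ (proj₂ quotient)))
      approx : Fin n → Fin n → Bool
      approx x y = adj (lookup R (centre x)) y
      approx-const : ∀ x x′ y y′ → part x ≡ part x′ → part y ≡ part y′ → approx x y ≡ approx x′ y′
      approx-const x x′ y y′ px py = trans (cong (λ i → adj (lookup R i) y) (key-centre x x′ (part⇒key x x′ px)))
                                           (key-adj y y′ (part⇒key y y′ py) (centre x′))
      err : Fin n → Fin n → ℕ
      err x y = ind (adj x y xor approx x y)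
      H : Fin n → Fin n → Bool
      H x y = ⌊ Blocks.uniform? part (suc b) err (part x) (part y) ⌋
      H⇒homogeneous : ∀ x y → T (H x y) → NatHomogeneous G b (cell (part x)) (cell (part y))
      H⇒homogeneous x y h = uniform⇒homogeneous G 𝒫 approx approx-const b x y (toWitness h)
      -- The errors in row x number exactly the distance from x to its centre, which is less than n
      -- / (b + 1)².
      few-errors : suc b * (suc b * (∑[ x < n ] ∑[ y < n ] err x y)) ≤ n * n
      few-errors = begin
        suc b * (suc b * (∑[ x < n ] ∑[ y < n ] err x y))        ≡⟨ *-assoc (suc b) (suc b) _ ⟨
        suc b * suc b * (∑[ x < n ] ∑[ y < n ] err x y)          ≡⟨ *-distribˡ-sum (suc b * suc b) (λ x → sum (err x)) ⟩
        ∑[ x < n ] (suc b * suc b * dist G x (lookup R (centre x))) ≤⟨ sum-mono (λ x → <⇒≤ (lookup-index (x-near x))) ⟩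
        ∑[ x < n ] n                                             ≡⟨ sum-const n n ⟩
        n * n                                                    ∎
      m<2^L : m < 2 ^ L
      m<2^L = packing-bound G vc (suc b * suc b) z<s R far
      -- The additional `suc` in the exponent absorbs the choice of centre, via m ≤ 2 ^ m.
      K≤2^2^ : K ≤ 2 ^ (2 ^ suc L)
      K≤2^2^ = begin
        K                     ≤⟨ proj₁ (proj₂ quotient) ⟩
        m * 2 ^ m             ≤⟨ *-monoˡ-≤ (2 ^ m) (<⇒≤ (n<2^n m)) ⟩
        2 ^ m * 2 ^ m         ≡⟨ ^-distribˡ-+-* 2 m m ⟨
        2 ^ (m + m)           ≤⟨ ^-monoʳ-≤ 2 (+-mono-≤ (<⇒≤ m<2^L) (<⇒≤ m<2^L)) ⟩
        2 ^ (2 ^ L + 2 ^ L)   ≡⟨ cong (λ k → 2 ^ (2 ^ L + k)) (+-identityʳ (2 ^ L)) ⟨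
        2 ^ (2 ^ suc L)       ∎

-- From natural numbers to Dedekind reals

module Reals where

  open import Data.Integer.Base as ℤ using (+_; +<+; +≤+; +[1+_]; -[1+_])
  import Data.Integer.Properties as ℤ
  open import Data.List.Base using ([]; _∷_)
  open import Data.Fin.Subset using (∣_∣)
  open import Data.Nat.Base using (zero; z≤n; s≤s; z<s)
  import Data.Nat.Properties as ℕ
  open import Data.Nat.Tactic.RingSolver using (solve-∀)
  open import Data.Product.Base using (proj₁; proj₂)
  open import Data.Rational.Base hiding (∣_∣)
  open import Data.Rational.Properties
  open import Data.Rational.Unnormalised.Base as ℚᵘ using (mkℚᵘ)
  import Data.Rational.Unnormalised.Properties as ℚᵘ
  open import Data.Sum.Base using (inj₁; inj₂)
  open import Function.Bundles using (Equivalence)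
  open import Algebra.Definitions.RawSemiring +-*-rawSemiring using (_^_)
  open Combinatorics using (pairCount; NatHomogeneous; packingLog)

  frac : ℕ → ℕ → ℚ
  frac a b = + a / suc b

  -- Rationals are stored in lowest terms. Passing to the unnormalised fraction reduces comparisons
  -- to cross-multiplication.
  frac≃ : ∀ a b → toℚᵘ (frac a b) ℚᵘ.≃ mkℚᵘ (+ a) b
  frac≃ a b = toℚᵘ-fromℚᵘ (mkℚᵘ (+ a) b)

  frac-≤ : ∀ {a b c d} → a ℕ.* suc d ℕ.≤ c ℕ.* suc b → frac a b ≤ frac c d
  frac-≤ {a} {b} {c} {d} le = toℚᵘ-cancel-≤ (begin
    toℚᵘ (frac a b) ≃⟨ frac≃ a b ⟩
    mkℚᵘ (+ a) b    ≤⟨ ℚᵘ.*≤* (subst₂ ℤ._≤_ (ℤ.pos-* a (suc d)) (ℤ.pos-* c (suc b)) (+≤+ le)) ⟩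
    mkℚᵘ (+ c) d    ≃⟨ frac≃ c d ⟨
    toℚᵘ (frac c d) ∎)
    where open ℚᵘ.≤-Reasoning

  frac-≤⁻ : ∀ {a b c d} → frac a b ≤ frac c d → a ℕ.* suc d ℕ.≤ c ℕ.* suc b
  frac-≤⁻ {a} {b} {c} {d} le with begin
    mkℚᵘ (+ a) b    ≃⟨ frac≃ a b ⟨
    toℚᵘ (frac a b) ≤⟨ toℚᵘ-mono-≤ le ⟩
    toℚᵘ (frac c d) ≃⟨ frac≃ c d ⟩
    mkℚᵘ (+ c) d    ∎
    where open ℚᵘ.≤-Reasoning
  ... | ℚᵘ.*≤* le′ = ℤ.drop‿+≤+ (subst₂ ℤ._≤_ (sym (ℤ.pos-* a (suc d))) (sym (ℤ.pos-* c (suc b))) le′)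

  frac-< : ∀ {a b c d} → a ℕ.* suc d ℕ.< c ℕ.* suc b → frac a b < frac c d
  frac-< {a} {b} {c} {d} lt = ≰⇒> λ le → ℕ.<⇒≱ lt (frac-≤⁻ {c} {d} {a} {b} le)

  frac-cong : ∀ {a b c d} → a ℕ.* suc d ≡ c ℕ.* suc b → frac a b ≡ frac c d
  frac-cong {a} {b} {c} {d} eq =
    ≤-antisym (frac-≤ {a} {b} {c} {d} (ℕ.≤-reflexive eq)) (frac-≤ {c} {d} {a} {b} (ℕ.≤-reflexive (sym eq)))

  -- `d + b * suc d` is the predecessor of the product `suc b * suc d` of the denominators.
  frac-* : ∀ a b c d → frac a b * frac c d ≡ frac (a ℕ.* c) (d ℕ.+ b ℕ.* suc d)
  frac-* a b c d = toℚᵘ-injective (begin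
    toℚᵘ (frac a b * frac c d)             ≈⟨ toℚᵘ-homo-* (frac a b) (frac c d) ⟩
    toℚᵘ (frac a b) ℚᵘ.* toℚᵘ (frac c d)   ≈⟨ ℚᵘ.*-cong (frac≃ a b) (frac≃ c d) ⟩
    mkℚᵘ (+ a) b ℚᵘ.* mkℚᵘ (+ c) d         ≡⟨ cong (λ i → mkℚᵘ i (d ℕ.+ b ℕ.* suc d)) (ℤ.pos-* a c) ⟨
    mkℚᵘ (+ (a ℕ.* c)) (d ℕ.+ b ℕ.* suc d) ≈⟨ frac≃ (a ℕ.* c) (d ℕ.+ b ℕ.* suc d) ⟨
    toℚᵘ (frac (a ℕ.* c) (d ℕ.+ b ℕ.* suc d)) ∎)
    where open ℚᵘ.≃-Reasoning

  frac-+ : ∀ a c b → frac a b + frac c b ≡ frac (a ℕ.+ c) b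
  frac-+ a c b = trans (toℚᵘ-injective (begin
    toℚᵘ (frac a b + frac c b)             ≈⟨ toℚᵘ-homo-+ (frac a b) (frac c b) ⟩
    toℚᵘ (frac a b) ℚᵘ.+ toℚᵘ (frac c b)   ≈⟨ ℚᵘ.+-cong (frac≃ a b) (frac≃ c b) ⟩
    mkℚᵘ (+ a) b ℚᵘ.+ mkℚᵘ (+ c) b         ≡⟨ cong (λ i → mkℚᵘ i b′) (cong₂ ℤ._+_ (ℤ.pos-* a (suc b)) (ℤ.pos-* c (suc b))) ⟨
    mkℚᵘ (+ (a ℕ.* suc b ℕ.+ c ℕ.* suc b)) b′ ≈⟨ frac≃ _ b′ ⟨
    toℚᵘ (frac (a ℕ.* suc b ℕ.+ c ℕ.* suc b) b′) ∎)) (frac-cong {a ℕ.* suc b ℕ.+ c ℕ.* suc b} {b′} {a ℕ.+ c} {b} (lemma a c b))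
    where
    open ℚᵘ.≃-Reasoning
    b′ = b ℕ.+ b ℕ.* suc b
    lemma : ∀ a c b → (a ℕ.* suc b ℕ.+ c ℕ.* suc b) ℕ.* suc b ≡ (a ℕ.+ c) ℕ.* suc (b ℕ.+ b ℕ.* suc b)
    lemma = solve-∀

  1-frac : ∀ b → 1ℚ - frac 1 b ≡ frac b b
  1-frac b = begin
    1ℚ - frac 1 b                     ≡⟨ cong (_- frac 1 b) (frac-cong {b ℕ.+ 1} {b} {1} {0} (lemma b)) ⟨
    frac (b ℕ.+ 1) b - frac 1 b       ≡⟨ cong (_- frac 1 b) (frac-+ b 1 b) ⟨
    frac b b + frac 1 b - frac 1 b    ≡⟨ +-assoc (frac b b) (frac 1 b) _ ⟩
    frac b b + (frac 1 b - frac 1 b)  ≡⟨ cong (λ q → frac b b + q) (+-inverseʳ (frac 1 b)) ⟩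
    frac b b + 0ℚ                     ≡⟨ +-identityʳ (frac b b) ⟩
    frac b b                          ∎
    where
    open ≡-Reasoning
    lemma : ∀ b → (b ℕ.+ 1) ℕ.* 1 ≡ 1 ℕ.* suc b
    lemma = solve-∀

  fromℕ-mono-≤ : ∀ {a c} → a ℕ.≤ c → fromℕ a ≤ fromℕ c
  fromℕ-mono-≤ {a} {c} a≤c = frac-≤ {a} {0} {c} {0} (ℕ.*-monoˡ-≤ 1 a≤c)

  0≤fromℕ : ∀ a → 0ℚ ≤ fromℕ a
  0≤fromℕ a = fromℕ-mono-≤ {0} {a} z≤n

  ^-mono-≤ : ∀ {q r} k → 0ℚ ≤ q → q ≤ r → 0ℚ ≤ q ^ k × q ^ k ≤ r ^ k
  ^-mono-≤ zero    0≤q q≤r = 0≤fromℕ 1 , ≤-refl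
  ^-mono-≤ {q} {r} (suc k) 0≤q q≤r with ^-mono-≤ {q} {r} k 0≤q q≤r
  ... | 0≤q^k , q^k≤r^k =
      subst (_≤ q * q ^ k) (*-zeroʳ q) (*-monoˡ-≤-nonNeg q {{nonNegative 0≤q}} 0≤q^k)
    , ≤-trans (*-monoˡ-≤-nonNeg q {{nonNegative 0≤q}} q^k≤r^k)
              (*-monoʳ-≤-nonNeg (r ^ k) {{nonNegative (≤-trans 0≤q^k q^k≤r^k)}} q≤r)

  fromℕ-^ : ∀ a k → fromℕ (a ℕ.^ k) ≡ fromℕ a ^ k
  fromℕ-^ a zero    = refl
  fromℕ-^ a (suc k) = trans (sym (frac-* a 0 (a ℕ.^ k) 0)) (cong (fromℕ a *_) (fromℕ-^ a k))

  -- Takes the place of extracting a root, as `2^ᵘ_` compares powers instead of using fractional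
  -- exponents.
  ^-cancel-≤ : ∀ a {q} k → 0ℚ < q → fromℕ (a ℕ.^ suc k) ≤ q ^ suc k → fromℕ a ≤ q
  ^-cancel-≤ a {q} k 0<q a^k≤q^k = ≮⇒≥ λ q<a → <-irrefl refl (begin-strict
    q ^ suc k               ≤⟨ *-monoˡ-≤-nonNeg q {{nonNegative (<⇒≤ 0<q)}} (proj₂ (^-mono-≤ k (<⇒≤ 0<q) (<⇒≤ q<a))) ⟩
    q * fromℕ a ^ k         <⟨ *-monoˡ-<-pos (fromℕ a ^ k) {{positive (a^k-pos (<-trans 0<q q<a) k)}} q<a ⟩
    fromℕ a * fromℕ a ^ k   ≡⟨ fromℕ-^ a (suc k) ⟨
    fromℕ (a ℕ.^ suc k)     ≤⟨ a^k≤q^k ⟩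
    q ^ suc k               ∎)
    where
    open ≤-Reasoning
    a^k-pos : 0ℚ < fromℕ a → ∀ k → 0ℚ < fromℕ a ^ k
    a^k-pos 0<a zero    = frac-< {0} {0} {1} {0} z<s
    a^k-pos 0<a (suc k) = subst (_< fromℕ a * fromℕ a ^ k) (*-zeroʳ (fromℕ a))
      (*-monoʳ-<-pos (fromℕ a) {{positive 0<a}} (a^k-pos 0<a k))

  -- Natural lower bounds for upper cuts

  fromℕ-≤ᵘ : ∀ m → m ≤ᵘ fromℕᵘ m
  fromℕ-≤ᵘ m q = <⇒≤

  +-≤ᵘ : ∀ {m n x y} → m ≤ᵘ x → n ≤ᵘ y → (m ℕ.+ n) ≤ᵘ (x +ᵘ y)
  +-≤ᵘ {m} {n} m≤x n≤y q (a , b , xa , yb , a+b≤q) =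
    ≤-trans (≤-reflexive (sym (frac-+ m n 0))) (≤-trans (+-mono-≤ (m≤x a xa) (n≤y b yb)) a+b≤q)

  *-≤ᵘ : ∀ {m n x y} → m ≤ᵘ x → n ≤ᵘ y → (m ℕ.* n) ≤ᵘ (x *ᵘ y)
  *-≤ᵘ {m} {n} m≤x n≤y q (a , b , xa , yb , ab≤q) = begin
    fromℕ (m ℕ.* n)    ≡⟨ frac-* m 0 n 0 ⟨
    fromℕ m * fromℕ n  ≤⟨ *-monoʳ-≤-nonNeg (fromℕ n) {{nonNegative (0≤fromℕ n)}} (m≤x a xa) ⟩
    a * fromℕ n        ≤⟨ *-monoˡ-≤-nonNeg a {{nonNegative (≤-trans (0≤fromℕ m) (m≤x a xa))}} (n≤y b yb) ⟩
    a * b              ≤⟨ ab≤q ⟩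
    q                  ∎
    where open ≤-Reasoning

  -- If a rational with numerator l and denominator k lies above x, then m k ≤ l, so (2 ^ m) ^ k ≤ 2
  -- ^ l ≤ q ^ k, and the exponent k is cancelled.
  2^-≤ᵘ : ∀ {m x} → m ≤ᵘ x → (2 ℕ.^ m) ≤ᵘ (2^ᵘ x)
  2^-≤ᵘ {m} m≤x q (l , k , x[l/k] , 0<q , 2^l≤q^k) = ^-cancel-≤ (2 ℕ.^ m) k 0<q (begin
    fromℕ ((2 ℕ.^ m) ℕ.^ suc k)  ≡⟨ cong fromℕ (ℕ.^-*-assoc 2 m (suc k)) ⟩
    fromℕ (2 ℕ.^ (m ℕ.* suc k))  ≤⟨ fromℕ-mono-≤ (ℕ.^-monoʳ-≤ 2 (ℕ.≤-trans (frac-≤⁻ {m} {0} {l} {k} (m≤x _ x[l/k])) (ℕ.≤-reflexive (ℕ.*-identityʳ l)))) ⟩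
    fromℕ (2 ℕ.^ l)              ≤⟨ 2^l≤q^k ⟩
    q ^ suc k                    ∎)
    where open ≤-Reasoning

  eval : Polynomial → ℕ → ℕ
  eval []      s = 0
  eval (c ∷ p) s = c ℕ.+ s ℕ.* eval p s

  eval-≤ᵘ : ∀ p {s x} → s ≤ᵘ x → eval p s ≤ᵘ evalᵘ p x
  eval-≤ᵘ []      s≤x = fromℕ-≤ᵘ 0
  eval-≤ᵘ (c ∷ p) {s} {x} s≤x =
    +-≤ᵘ {c} {s ℕ.* eval p s} {fromℕᵘ c} (fromℕ-≤ᵘ c) (*-≤ᵘ {s} {eval p s} {x} {evalᵘ p x} s≤x (eval-≤ᵘ p s≤x))

  ≤ᵘ-trans : ∀ {m n x} → m ℕ.≤ n → n ≤ᵘ x → m ≤ᵘ x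
  ≤ᵘ-trans m≤n n≤x q xq = ≤-trans (fromℕ-mono-≤ m≤n) (n≤x q xq)

  -- Comparing ε with unit fractions

  module _ (ε : ℝ) where
    open ℝ ε

    <ʳ-downward : ∀ {q r} → q < r → r <ʳ ε → q <ʳ ε
    <ʳ-downward q<r r<ε = Equivalence.from (lower-rounded _) (_ , q<r , r<ε)

    <ʳ-ʳ<⇒< : ∀ {q r} → q <ʳ ε → ε ʳ< r → q < r
    <ʳ-ʳ<⇒< {q} {r} q<ε ε<r = ≰⇒> λ r≤q → disjoint q (q<ε , ʳ<-upward r≤q)
      where
      ʳ<-upward : r ≤ q → ε ʳ< q
      ʳ<-upward r≤q with Equivalence.to (upper-rounded r) ε<r
      ... | r′ , r′<r , ε<r′ = Equivalence.from (upper-rounded q) (r′ , <-≤-trans r′<r r≤q , ε<r′)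

    ≤ᵘ-1/ : ∀ s → (∀ r → 0ℚ < r → r <ʳ ε → fromℕ s * r ≤ 1ℚ) → s ≤ᵘ (1/ᵘ ε)
    ≤ᵘ-1/ s sr≤1 q (r , 0<r , r<ε , 1≤qr) = ≮⇒≥ λ q<s → <-irrefl refl (begin-strict
      1ℚ           ≤⟨ 1≤qr ⟩
      q * r        <⟨ *-monoˡ-<-pos r {{positive 0<r}} q<s ⟩
      fromℕ s * r  ≤⟨ sr≤1 r 0<r r<ε ⟩
      1ℚ           ∎)
      where open ≤-Reasoning

    0≤ᵘ-1/ : 0 ≤ᵘ (1/ᵘ ε)
    0≤ᵘ-1/ = ≤ᵘ-1/ 0 λ r _ _ → ≤-trans (≤-reflexive (*-zeroˡ r)) (0≤fromℕ 1)

    suc≤ᵘ-1/ : ∀ s → ε ʳ< frac 1 s → suc s ≤ᵘ (1/ᵘ ε)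
    suc≤ᵘ-1/ s ε<1/s = ≤ᵘ-1/ (suc s) λ r 0<r r<ε → begin
      fromℕ (suc s) * r         ≤⟨ *-monoˡ-≤-nonNeg (fromℕ (suc s)) {{nonNegative (0≤fromℕ (suc s))}} (<⇒≤ (<ʳ-ʳ<⇒< r<ε ε<1/s)) ⟩
      fromℕ (suc s) * frac 1 s  ≡⟨ frac-* (suc s) 0 1 s ⟩
      frac (suc s ℕ.* 1) (s ℕ.+ 0) ≡⟨ frac-cong {suc s ℕ.* 1} {s ℕ.+ 0} {1} {0} (lemma s) ⟩
      1ℚ                        ∎
      where
      open ≤-Reasoning
      lemma : ∀ s → suc s ℕ.* 1 ℕ.* 1 ≡ 1 ℕ.* suc (s ℕ.+ 0)
      lemma = solve-∀

    unit-fraction-< : ∀ s → frac 1 (suc s) < frac 1 s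
    unit-fraction-< s = frac-< {1} {suc s} {1} {s} (ℕ.≤-reflexive (lemma s))
      where
      lemma : ∀ s → suc (1 ℕ.* suc s) ≡ 1 ℕ.* suc (suc s)
      lemma = solve-∀

    unit-fraction-below : 0ℚ <ʳ ε → ∃ λ s → frac 1 s <ʳ ε
    unit-fraction-below 0<ε with Equivalence.to (lower-rounded 0ℚ) 0<ε
    ... | mkℚ (+ 0)      d _ , *<* (+<+ ()) , _
    ... | mkℚ (-[1+ _ ]) d _ , *<* () , _
    -- Here 1 / (d + 1) ≤ r; the next unit fraction, 1 / (d + 2), is strictly below r, as
    -- `<ʳ-downward` demands.
    ... | r@(mkℚ (+[1+ k ]) d _) , 0<r , r<ε = suc d , <ʳ-downward (<-≤-trans (unit-fraction-< d) (begin
      frac 1 d        ≤⟨ frac-≤ {1} {d} {suc k} {d} (ℕ.*-monoˡ-≤ (suc d) (s≤s {n = k} z≤n)) ⟩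
      frac (suc k) d  ≡⟨ ↥p/↧p≡p r ⟩
      r               ∎)) r<ε
      where open ≤-Reasoning

    -- Locatedness decides, up to overlap, between 1/(s+2) < ε and ε < 1/(s+1).
    floor-1/ : 0ℚ <ʳ ε → ∃ λ s → s ≤ᵘ (1/ᵘ ε) × frac 1 (suc s) <ʳ ε
    floor-1/ 0<ε = let t , 1/t<ε = unit-fraction-below 0<ε in search t 0 0≤ᵘ-1/ (subst (λ k → frac 1 k <ʳ ε) (sym (ℕ.+-identityʳ t)) 1/t<ε)
      where
      -- The sum t + s stays fixed with 1 / (t + s + 1) < ε, so the search stops at the latest when
      -- t reaches 0.
      search : ∀ t s → s ≤ᵘ (1/ᵘ ε) → frac 1 (t ℕ.+ s) <ʳ ε → ∃ λ s → s ≤ᵘ (1/ᵘ ε) × frac 1 (suc s) <ʳ ε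
      search zero    s s≤1/ε 1/s<ε = s , s≤1/ε , <ʳ-downward (unit-fraction-< s) 1/s<ε
      search (suc t) s s≤1/ε 1/t+s<ε with located (unit-fraction-< s)
      ... | inj₁ 1/s<ε = s , s≤1/ε , 1/s<ε
      ... | inj₂ ε<1/s = search t (suc s) (suc≤ᵘ-1/ s ε<1/s) (subst (λ k → frac 1 k <ʳ ε) (sym (ℕ.+-suc t s)) 1/t+s<ε)

    module _ {n : ℕ} (G : Graph n) (b : ℕ) (1/b<ε : frac 1 b <ʳ ε) where

      1-q≤frac : ∀ {q} → ε ʳ< q → 1ℚ - q ≤ frac b b
      1-q≤frac {q} ε<q = subst (1ℚ - q ≤_) (1-frac b) (+-monoʳ-≤ 1ℚ (neg-antimono-≤ (<⇒≤ (<ʳ-ʳ<⇒< 1/b<ε ε<q))))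

      NatHomogeneous⇒Homogeneous : ∀ X Y → NatHomogeneous G b X Y → Homogeneous G ε X Y
      NatHomogeneous⇒Homogeneous X Y h with ∣ X ∣ ℕ.* ∣ Y ∣
      -- An empty side has density 0 by convention, which is at most any q above ε because 1 / (b +
      -- 1) is positive and below q.
      ... | zero = inj₁ (≤-refl , λ q ε<q → <⇒≤ (≤-<-trans (0≤frac 1 b) (<ʳ-ʳ<⇒< 1/b<ε ε<q)))
        where
        0≤frac : ∀ a c → 0ℚ ≤ frac a c
        0≤frac a c = frac-≤ {0} {0} {a} {c} z≤n
      NatHomogeneous⇒Homogeneous X Y (inj₁ few) | suc m = inj₁
        ( frac-≤ {0} {0} {edgePairs G X Y} {m} z≤n
        , λ q ε<q → ≤-trans (frac-≤ {edgePairs G X Y} {m} {1} {b} (subst₂ ℕ._≤_ (ℕ.*-comm (suc b) _) (sym (ℕ.*-identityˡ (suc m))) few))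
                            (<⇒≤ (<ʳ-ʳ<⇒< 1/b<ε ε<q)))
      NatHomogeneous⇒Homogeneous X Y (inj₂ (many , e≤)) | suc m = inj₂
        ( (λ q ε<q → ≤-trans (1-q≤frac ε<q) (frac-≤ {b} {b} {edgePairs G X Y} {m} (subst (b ℕ.* suc m ℕ.≤_) (ℕ.*-comm (suc b) _) many)))
        , frac-≤ {edgePairs G X Y} {m} {1} {0} (subst₂ ℕ._≤_ (sym (ℕ.*-identityʳ _)) (sym (ℕ.*-identityˡ (suc m))) e≤))

      most-pairs : ∀ H → b ℕ.* (n ℕ.* n) ℕ.≤ suc b ℕ.* pairCount G H →
                   ∀ q → ε ʳ< q → (1ℚ - q) * fromℕ (n ℕ.* n) ≤ fromℕ (pairCount G H)
      most-pairs H many q ε<q = begin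
        (1ℚ - q) * fromℕ m        ≤⟨ *-monoʳ-≤-nonNeg (fromℕ m) {{nonNegative (0≤fromℕ m)}} (1-q≤frac ε<q) ⟩
        frac b b * fromℕ m        ≡⟨ frac-* b b m 0 ⟩
        frac (b ℕ.* m) (b ℕ.* 1)  ≤⟨ frac-≤ {b ℕ.* m} {b ℕ.* 1} {c} {0} (subst₂ ℕ._≤_ (sym (ℕ.*-identityʳ _)) (lemma b c) many) ⟩
        fromℕ c                   ∎
        where
        open ≤-Reasoning
        m = n ℕ.* n
        c = pairCount G H
        lemma : ∀ b c → suc b ℕ.* c ≡ c ℕ.* suc (b ℕ.* 1)
        lemma = solve-∀

  -- The expansion in s of 1 + 3 e (6 e + (s + 2)²), where a = (s + 2)² belongs to the unit fraction
  -- 1 / (s + 2) supplied by `floor-1/`.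
  bound : ℕ → Polynomial
  bound d = suc (3 ℕ.* e ℕ.* (6 ℕ.* e ℕ.+ 4)) ∷ 12 ℕ.* e ∷ 3 ℕ.* e ∷ []
    where e = suc d

  eval-bound : ∀ d s → suc (packingLog (suc d) (suc (suc s) ℕ.* suc (suc s))) ≡ eval (bound d) s
  eval-bound d s = lemma (suc d) s
    where
    lemma : ∀ e s → suc (3 ℕ.* e ℕ.* (6 ℕ.* e ℕ.+ suc (suc s) ℕ.* suc (suc s))) ≡
            suc (3 ℕ.* e ℕ.* (6 ℕ.* e ℕ.+ 4)) ℕ.+ s ℕ.* (12 ℕ.* e ℕ.+ s ℕ.* (3 ℕ.* e ℕ.+ s ℕ.* 0))
    lemma = solve-∀

open Combinatorics using (nat-regularity)
open Reals

proposition1p7 : (d : ℕ) →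
    ∃ λ (p : Polynomial) →
    (n : ℕ) (G : Graph n) → GraphVCDim≤ G d →
    (ε : ℝ) → 0ℚ <ʳ ε →
    ∃ λ (K : ℕ) →
    (K ≤ᵘ 2^ᵘ (2^ᵘ (evalᵘ p (1/ᵘ ε)))) ×
    Σ (Partition n K) λ 𝒫 → let open Partition 𝒫 in
    MostPairs ε (λ x y → Homogeneous G ε (cell (part x)) (cell (part y)))
proposition1p7 d = bound d , λ n G vc ε 0<ε →
  let s , s≤1/ε , 1/s<ε = floor-1/ ε 0<ε
      K , K≤ , 𝒫 , H , H⇒homogeneous , most = nat-regularity G vc (suc s)
      x = evalᵘ (bound d) (1/ᵘ ε)
  in K
   , ≤ᵘ-trans {x = 2^ᵘ (2^ᵘ x)} (subst (λ m → K ℕ.≤ 2 ℕ.^ (2 ℕ.^ m)) (eval-bound d s) K≤)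
       (2^-≤ᵘ {2 ℕ.^ eval (bound d) s} {2^ᵘ x} (2^-≤ᵘ {eval (bound d) s} {x} (eval-≤ᵘ (bound d) {s} {1/ᵘ ε} s≤1/ε)))
   , 𝒫 , H
   , (λ x y h → NatHomogeneous⇒Homogeneous ε G (suc s) 1/s<ε _ _ (H⇒homogeneous x y h))
   , most-pairs ε G (suc s) 1/s<ε H most
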